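{- There is an absolute constant $C$ such that for every positive integer $t$, every graph of twin-width at most $2$ which does not contain $K_{t,t}$ as a subgraph has tree-width at most $C\,t$ (i.e., tree-width $O(t)$).
   Context: All graphs are finite and simple. $K_{t,t}$ is the complete bipartite graph with $t$ vertices on each side. Twin-width: for a partition $\mathcal P$ of $V(G)$, the quotient trigraph $G/\mathcal P$ has parts as vertices, with a red edge between two parts that are neither fully adjacent nor fully non-adjacent (black if fully adjacent, none if non-adjacent); a partition sequence starts from singletons and merges two parts per step; width is the maximum red degree over all quotients; twin-width is the minimum width. Tree-width is the standard graph parameter. -}

module Defs where

open import Data.Nat using (ℕ; zero; suc; _+_; _*_; _≤_)
open import Data.Bool using (Bool; true; false; _∧_; _∨_; not)
open import Data.Fin using (Fin; zero; suc; inject₁; fromℕ; _≟_)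
open import Data.Fin.Subset using (Subset; _∈_; ∣_∣)
open import Data.Vec using (tabulate)
open import Data.Product using (Σ; ∃; _×_; _,_)
open import Data.Sum using (_⊎_)
open import Relation.Nullary using (¬_; ⌊_⌋)
open import Relation.Binary.PropositionalEquality using (_≡_; _≢_)
open import Function.Definitions using (Injective)
open import Function.Bundles using (_⇔_)

record Graph : Set where
  field
    n     : ℕ
    adj   : Fin n → Fin n → Bool
    sym   : ∀ x y → adj x y ≡ adj y x
    loopless : ∀ x → adj x x ≡ false
open Graph public

anyF : ∀ {k} → (Fin k → Bool) → Bool
anyF {zero}  f = false
anyF {suc k} f = f zero ∨ anyF (λ i → f (suc i))

ContainsKtt : ℕ → Graph → Set
ContainsKtt t G =
  Σ (Fin t → Fin (n G)) λ a → Σ (Fin t → Fin (n G)) λ b →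
    Injective _≡_ _≡_ a × Injective _≡_ _≡_ b ×
    (∀ i j → a i ≢ b j) × (∀ i j → adj G (a i) (b j) ≡ true)

record Partition (n : ℕ) : Set where
  field
    k    : ℕ
    lab  : Fin n → Fin k
    surj : ∀ a → ∃ λ x → lab x ≡ a
open Partition public

red : (G : Graph) (P : Partition (n G)) → Fin (k P) → Fin (k P) → Bool
red G P a b =
  not ⌊ a ≟ b ⌋
  ∧ anyF (λ x → anyF (λ y → ⌊ lab P x ≟ a ⌋ ∧ ⌊ lab P y ≟ b ⌋ ∧ adj G x y))
  ∧ anyF (λ x → anyF (λ y → ⌊ lab P x ≟ a ⌋ ∧ ⌊ lab P y ≟ b ⌋ ∧ not (adj G x y)))

redDeg : (G : Graph) (P : Partition (n G)) → Fin (k P) → ℕ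
redDeg G P a = ∣ tabulate (λ b → red G P a b) ∣

RedBounded : (G : Graph) → ℕ → Partition (n G) → Set
RedBounded G d P = ∀ a → redDeg G P a ≤ d

Merge : ∀ {n} → Partition n → Partition n → Set
Merge P P' = Σ (Fin (k P)) λ i → Σ (Fin (k P)) λ j → i ≢ j ×
  (∀ x y → (lab P' x ≡ lab P' y) ⇔
     (lab P x ≡ lab P y ⊎ (lab P x ≡ i × lab P y ≡ j) ⊎ (lab P x ≡ j × lab P y ≡ i)))

Trivial : ∀ {n} → Partition n → Set
Trivial P = ∀ x y → lab P x ≡ lab P y

Discrete : ∀ {n} → Partition n → Set
Discrete P = Injective _≡_ _≡_ (lab P)

data SeqFrom (G : Graph) (d : ℕ) : Partition (n G) → Set where
  done : ∀ {P} → RedBounded G d P → Trivial P → SeqFrom G d P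
  step : ∀ {P P'} → RedBounded G d P → Merge P P' → SeqFrom G d P' → SeqFrom G d P

TwwAtMost : ℕ → Graph → Set
TwwAtMost d G = Σ (Partition (n G)) λ P → Discrete P × SeqFrom G d P

data Walk (G : Graph) (S : Fin (n G) → Set) : Fin (n G) → Fin (n G) → Set where
  nil  : ∀ {x} → S x → Walk G S x x
  cons : ∀ {x y z} → S x → adj G x y ≡ true → Walk G S y z → Walk G S x z

ConnectedOn : (G : Graph) → (Fin (n G) → Set) → Set
ConnectedOn G S = ∀ x y → S x → S y → Walk G S x y

HasCycle : Graph → Set
HasCycle G = Σ ℕ λ ℓ → Σ (Fin (3 + ℓ) → Fin (n G)) λ c →
  Injective _≡_ _≡_ c ×
  (∀ (i : Fin (2 + ℓ)) → adj G (c (inject₁ i)) (c (suc i)) ≡ true) ×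
  adj G (c (fromℕ (2 + ℓ))) (c zero) ≡ true

IsTree : Graph → Set
IsTree T = (1 ≤ n T) × ConnectedOn T (λ _ → Data.Unit.⊤) × ¬ HasCycle T
  where import Data.Unit

record TreeDecomp (G : Graph) (w : ℕ) : Set where
  field
    T        : Graph
    isTree   : IsTree T
    bag      : Fin (n T) → Subset (n G)
    covV     : ∀ v → ∃ λ i → v ∈ bag i
    covE     : ∀ u v → adj G u v ≡ true → ∃ λ i → u ∈ bag i × v ∈ bag i
    connV    : ∀ v → ConnectedOn T (λ i → v ∈ bag i)
    width    : ∀ i → ∣ bag i ∣ ≤ suc w

TwAtMost : ℕ → Graph → Set
TwAtMost w G = TreeDecomp G w

{-# OPTIONS --safe #-}

-- Run the contraction sequence backwards, from the trivial partition to the discrete one.  Call a part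
-- big if it has at least t vertices; a big part has fewer than t common neighbours, so every black edge
-- at a big part is cheap to separate.  Maintain a binary tree whose leaves are the current parts, such
-- that each cut (the vertices below a node against the rest) is covered by O(t) vertices except for
-- boundedly many pending red pairs of big parts.  When A splits into A₁ and A₂, a pending pair A–C gives
-- rise to at most one new red pair, unless C is red to both halves.  In that case C has no further red
-- neighbour, because the red degree is at most 2, and moving the leaf C next to A removes the pair A–C
-- from every cut at the price of the < 2t common neighbours of A and of C.  So the number of pending
-- pairs of a cut never grows, and each pair costs O(t) once.  For singletons this yields a balanced
-- separator of size O(t) for every vertex set, hence tree-width O(t) by the recursive argument of
-- Robertson and Seymour.
module Submission where

open import Defs
open import Data.Nat using (ℕ; zero; suc; _+_; _*_; _≤_; _<_; z≤n; s≤s; _≤?_; _<?_; >-nonZero)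
open import Data.Nat.Properties hiding (_≟_; suc-injective)
open import Data.Nat.Tactic.RingSolver using (solve-∀)
open import Data.Bool using (Bool; true; false; _∧_; _∨_; not; if_then_else_)
import Data.Bool.Properties as 𝔹
open import Data.Fin using (Fin; zero; suc; inject₁; fromℕ; _≟_; toℕ)
open import Data.Fin.Properties using (all?; any?; suc-injective; toℕ-inject₁)
open import Data.Fin.Relation.Unary.Top using (view; ‵fromℕ; ‵inject₁)
open import Data.Fin.Subset using (_∈_; ∣_∣)
open import Data.Vec using (tabulate)
open import Data.Vec.Properties using (lookup∘tabulate; lookup⇒[]=; []=⇒lookup)
open import Data.List using (List; []; _∷_; length; map; concatMap)
open import Data.List.Properties using (length-map; length-++)
import Data.List.Membership.DecPropositional as DecMembership
open import Data.List.Membership.Propositional using () renaming (_∈_ to _∈ˡ_)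
open import Data.List.Membership.Propositional.Properties using (∈-map⁺; ∈-map⁻)
open import Data.List.Relation.Unary.Any as Any using (Any; here; there)
import Data.List.Relation.Unary.Any.Properties as Any
open import Data.Product using (Σ; ∃; _×_; _,_; proj₁; proj₂; Σ-syntax)
open import Data.Sum using (_⊎_; inj₁; inj₂; [_,_]′; swap)
open import Data.Empty using (⊥; ⊥-elim)
open import Data.Unit using (⊤; tt)
open import Function using (_∘_; case_of_)
open import Function.Definitions using (Injective)
open import Function.Bundles using (Equivalence)
open import Relation.Nullary using (¬_; Dec; yes; no; ⌊_⌋)
open import Relation.Nullary.Decidable using (_×-dec_; _→-dec_)
open import Relation.Binary.PropositionalEquality as ≡ using (_≡_; _≢_; refl; cong; cong₂; subst; subst₂; trans)

open module Membership {k} = DecMembership (_≟_ {k}) using (_∈?_)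

-- Boolean connectives and bounded search

∨-trueˡ : ∀ {a b} → a ≡ true → a ∨ b ≡ true
∨-trueˡ refl = refl

∨-trueʳ : ∀ {a b} → b ≡ true → a ∨ b ≡ true
∨-trueʳ {true}  _ = refl
∨-trueʳ {false} p = p

∨-split : ∀ {a b} → a ∨ b ≡ true → a ≡ true ⊎ b ≡ true
∨-split {true}  _ = inj₁ refl
∨-split {false} p = inj₂ p

∧-true : ∀ {a b} → a ≡ true → b ≡ true → a ∧ b ≡ true
∧-true refl p = p

∧-split : ∀ {a b} → a ∧ b ≡ true → a ≡ true × b ≡ true
∧-split {true} p = refl , p

not-true : ∀ {a} → a ≡ false → not a ≡ true
not-true refl = refl

not-split : ∀ {a} → not a ≡ true → a ≡ false
not-split {false} _ = refl

true≢false : ∀ {a} {X : Set} → a ≡ true → a ≡ false → X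
true≢false refl ()

bool-cases : ∀ a → a ≡ true ⊎ a ≡ false
bool-cases true  = inj₁ refl
bool-cases false = inj₂ refl

⌊⌋-intro : ∀ {A : Set} {d : Dec A} → A → ⌊ d ⌋ ≡ true
⌊⌋-intro {d = yes _} _ = refl
⌊⌋-intro {d = no ¬a} a = ⊥-elim (¬a a)

⌊⌋-elim : ∀ {A : Set} {d : Dec A} → ⌊ d ⌋ ≡ true → A
⌊⌋-elim {d = yes a} _ = a

anyF-intro : ∀ {k} (f : Fin k → Bool) x → f x ≡ true → anyF f ≡ true
anyF-intro f zero    p = ∨-trueˡ p
anyF-intro f (suc x) p = ∨-trueʳ {f zero} (anyF-intro (f ∘ suc) x p)

anyF-elim : ∀ {k} (f : Fin k → Bool) → anyF f ≡ true → ∃ λ x → f x ≡ true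
anyF-elim {suc k} f p with ∨-split {f zero} p
... | inj₁ q = zero , q
... | inj₂ q with anyF-elim (f ∘ suc) q
...   | x , r = suc x , r

-- Finite sets and their cardinalities

FinSet : ℕ → Set
FinSet n = Fin n → Bool

infix 4 _⊑_
_⊑_ : ∀ {n} → FinSet n → FinSet n → Set
f ⊑ g = ∀ x → f x ≡ true → g x ≡ true

infixr 6 _∪_
infixr 7 _∩_
_∪_ _∩_ _∖_ : ∀ {n} → FinSet n → FinSet n → FinSet n
(f ∪ g) x = f x ∨ g x
(f ∩ g) x = f x ∧ g x
(f ∖ g) x = f x ∧ not (g x)

bit : Bool → ℕ
bit true  = 1
bit false = 0

card : ∀ {n} → FinSet n → ℕ
card {zero}  f = 0
card {suc n} f = bit (f zero) + card (f ∘ suc)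

-- Links this count to the `Subset` cardinality of the statement. Elsewhere sets stay Boolean
-- functions, whose unions and differences compute pointwise.
card-tabulate : ∀ {n} (f : FinSet n) → ∣ tabulate f ∣ ≡ card f
card-tabulate {zero}  f = refl
card-tabulate {suc n} f with f zero
... | true  = cong suc (card-tabulate (f ∘ suc))
... | false = card-tabulate (f ∘ suc)

bit-mono : ∀ {a b} → (a ≡ true → b ≡ true) → bit a ≤ bit b
bit-mono {true}  h rewrite h refl = ≤-refl
bit-mono {false} h = z≤n

card-mono : ∀ {n} {f g : FinSet n} → f ⊑ g → card f ≤ card g
card-mono {zero}  h = z≤n
card-mono {suc n} h = +-mono-≤ (bit-mono (h zero)) (card-mono (h ∘ suc))

bit-∨ : ∀ a b → bit (a ∨ b) ≤ bit a + bit b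
bit-∨ true  b = s≤s z≤n
bit-∨ false b = ≤-refl

interchange : ∀ a b c d → (a + b) + (c + d) ≡ (a + c) + (b + d)
interchange = solve-∀

card-∪ : ∀ {n} (f g : FinSet n) → card (f ∪ g) ≤ card f + card g
card-∪ {zero}  f g = z≤n
card-∪ {suc n} f g = begin
  bit (f zero ∨ g zero) + card ((f ∪ g) ∘ suc)
    ≤⟨ +-mono-≤ (bit-∨ (f zero) (g zero)) (card-∪ (f ∘ suc) (g ∘ suc)) ⟩
  (bit (f zero) + bit (g zero)) + (card (f ∘ suc) + card (g ∘ suc))
    ≡⟨ interchange (bit (f zero)) _ _ _ ⟩
  card f + card g ∎
  where open ≤-Reasoning

bit-∧ : ∀ a b → bit a ≡ bit (a ∧ b) + bit (a ∧ not b)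
bit-∧ true  true  = refl
bit-∧ true  false = refl
bit-∧ false b     = refl

card-∩∖ : ∀ {n} (f g : FinSet n) → card f ≡ card (f ∩ g) + card (f ∖ g)
card-∩∖ {zero}  f g = refl
card-∩∖ {suc n} f g = trans
  (cong₂ _+_ (bit-∧ (f zero) (g zero)) (card-∩∖ (f ∘ suc) (g ∘ suc)))
  (interchange (bit (f zero ∧ g zero)) _ _ _)

card-∅ : ∀ {n} (f : FinSet n) → (∀ x → f x ≡ false) → card f ≡ 0
card-∅ {zero}  f h = refl
card-∅ {suc n} f h rewrite h zero = card-∅ (f ∘ suc) (h ∘ suc)

card-subsingleton : ∀ {n} (f : FinSet n) → (∀ x y → f x ≡ true → f y ≡ true → x ≡ y) → card f ≤ 1
card-subsingleton {zero}  f h = z≤n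
card-subsingleton {suc n} f h with bool-cases (f zero)
... | inj₁ p rewrite p = ≤-reflexive (cong suc (card-∅ (f ∘ suc) empty))
  where
  empty : ∀ x → f (suc x) ≡ false
  empty x with bool-cases (f (suc x))
  ... | inj₁ q = case h zero (suc x) p q of λ ()
  ... | inj₂ q = q
... | inj₂ p rewrite p =
  card-subsingleton (f ∘ suc) λ x y r s → suc-injective (h (suc x) (suc y) r s)

card-nonempty : ∀ {n} (f : FinSet n) x → f x ≡ true → 1 ≤ card f
card-nonempty f zero    p rewrite p = s≤s z≤n
card-nonempty f (suc x) p = ≤-trans (card-nonempty (f ∘ suc) x p) (m≤n+m _ (bit (f zero)))

card-distinct₃ : ∀ {n} (f : FinSet n) {a b c} → f a ≡ true → f b ≡ true → f c ≡ true →
  a ≢ b → a ≢ c → b ≢ c → 3 ≤ card f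
card-distinct₃ f {a} {b} {c} fa fb fc a≢b a≢c b≢c = begin
  1 + (1 + 1)
    ≤⟨ +-mono-≤ (card-nonempty _ a (∧-true fa (is a)))
        (+-mono-≤ (card-nonempty _ b (∧-true (∧-true fb (isn't (a≢b ∘ ≡.sym))) (is b)))
                  (card-nonempty _ c (∧-true (∧-true fc (isn't (a≢c ∘ ≡.sym))) (isn't (b≢c ∘ ≡.sym))))) ⟩
  card (f ∩ single a) + (card ((f ∖ single a) ∩ single b) + card ((f ∖ single a) ∖ single b))
    ≡⟨ cong (card (f ∩ single a) +_) (card-∩∖ (f ∖ single a) (single b)) ⟨
  card (f ∩ single a) + card (f ∖ single a)
    ≡⟨ card-∩∖ f (single a) ⟨
  card f ∎
  where
  open ≤-Reasoning
  single : _ → FinSet _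
  single a x = ⌊ x ≟ a ⌋
  is : ∀ x → single x x ≡ true
  is x = ⌊⌋-intro {d = x ≟ x} refl
  isn't : ∀ {x a} → x ≢ a → not (single a x) ≡ true
  isn't {x} {a} x≢a with x ≟ a
  ... | yes p = ⊥-elim (x≢a p)
  ... | no _  = refl

choose : ∀ {n} (f : FinSet n) t → t ≤ card f →
  Σ (Fin t → Fin n) λ g → Injective _≡_ _≡_ g × (∀ i → f (g i) ≡ true)
choose         f zero    h = (λ ()) , (λ { {()} }) , (λ ())
choose {suc n} f (suc t) h with bool-cases (f zero)
... | inj₂ p with choose (f ∘ suc) (suc t) (subst (λ b → suc t ≤ bit b + card (f ∘ suc)) p h)
...   | g , inj , mem = suc ∘ g , (λ e → inj (suc-injective e)) , mem
choose {suc n} f (suc t) h | inj₁ p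
  with choose (f ∘ suc) t (≤-pred (subst (λ b → suc t ≤ bit b + card (f ∘ suc)) p h))
... | g , inj , mem = g′ , inj′ , mem′
  where
  g′ : Fin (suc t) → Fin (suc n)
  g′ zero    = zero
  g′ (suc i) = suc (g i)
  inj′ : Injective _≡_ _≡_ g′
  inj′ {zero}  {zero}  e = refl
  inj′ {suc i} {suc j} e = cong suc (inj (suc-injective e))
  mem′ : ∀ i → f (g′ i) ≡ true
  mem′ zero    = p
  mem′ (suc i) = mem i

-- Serves to pad the interface `W` of the final recursion to exactly `6 * K` vertices, so that
-- balance is measured against one fixed number.
card-between : ∀ {n} (f g : FinSet n) m → f ⊑ g → card f ≤ m → m ≤ card g →
  Σ[ h ∈ FinSet n ] f ⊑ h × h ⊑ g × card h ≡ m
card-between {zero}  f g m f⊑g lo hi = f , (λ ()) , (λ ()) , ≡.sym (n≤0⇒n≡0 hi)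
card-between {suc n} f g m f⊑g lo hi with bool-cases (f zero) | bool-cases (g zero) | m ≤? card (g ∘ suc)
... | inj₁ p | inj₂ q | _ = true≢false (f⊑g zero p) q
... | inj₁ p | inj₁ q | _ = with-zero m lo hi
  where
  with-zero : ∀ m → card f ≤ m → m ≤ card g → Σ[ h ∈ FinSet (suc n) ] f ⊑ h × h ⊑ g × card h ≡ m
  with-zero m lo hi rewrite p | q with m | lo | hi
  ... | suc m | s≤s lo | s≤s hi with card-between (f ∘ suc) (g ∘ suc) m (f⊑g ∘ suc) lo hi
  ...   | h , f⊑h , h⊑g , e =
    (λ { zero → true ; (suc x) → h x }) , (λ { zero _ → refl ; (suc x) → f⊑h x }) ,
    (λ { zero _ → q ; (suc x) → h⊑g x }) , cong suc e
... | inj₂ p | inj₂ q | _ with card-between (f ∘ suc) (g ∘ suc) m (f⊑g ∘ suc)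
                                 (subst (λ b → bit b + card (f ∘ suc) ≤ m) p lo)
                                 (subst (λ b → m ≤ bit b + card (g ∘ suc)) q hi)
...   | h , f⊑h , h⊑g , e =
    (λ { zero → false ; (suc x) → h x }) , (λ { zero r → true≢false r p ; (suc x) → f⊑h x }) ,
    (λ { zero () ; (suc x) → h⊑g x }) , e
card-between {suc n} f g m f⊑g lo hi | inj₂ p | inj₁ q | yes m≤
  with card-between (f ∘ suc) (g ∘ suc) m (f⊑g ∘ suc) (subst (λ b → bit b + card (f ∘ suc) ≤ m) p lo) m≤
...   | h , f⊑h , h⊑g , e =
    (λ { zero → false ; (suc x) → h x }) , (λ { zero r → true≢false r p ; (suc x) → f⊑h x }) ,
    (λ { zero () ; (suc x) → h⊑g x }) , e
card-between {suc n} f g m f⊑g lo hi | inj₂ p | inj₁ q | no m≰ =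
  -- `m` exceeds the size of `g` without `zero`, so it equals `card g`.
  g , f⊑g , (λ _ r → r) , ≤-antisym (subst (λ b → bit b + card (g ∘ suc) ≤ m) (≡.sym q) (≰⇒> m≰)) hi

elems : ∀ {n} → FinSet n → List (Fin n)
elems {zero}  f = []
elems {suc n} f = if f zero then zero ∷ map suc (elems (f ∘ suc)) else map suc (elems (f ∘ suc))

length-elems : ∀ {n} (f : FinSet n) → length (elems f) ≡ card f
length-elems {zero}  f = refl
length-elems {suc n} f with f zero
... | true  = cong suc (trans (length-map suc (elems (f ∘ suc))) (length-elems (f ∘ suc)))
... | false = trans (length-map suc (elems (f ∘ suc))) (length-elems (f ∘ suc))

∈-elems : ∀ {n} (f : FinSet n) x → f x ≡ true → x ∈ˡ elems f
∈-elems f zero    p rewrite p = here refl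
∈-elems f (suc x) p with f zero
... | true  = there (∈-map⁺ suc (∈-elems (f ∘ suc) x p))
... | false = ∈-map⁺ suc (∈-elems (f ∘ suc) x p)

elems-∈ : ∀ {n} (f : FinSet n) {x} → x ∈ˡ elems f → f x ≡ true
elems-∈ {suc n} f x∈ with f zero in p
elems-∈ {suc n} f (here refl) | true = p
elems-∈ {suc n} f (there x∈)  | true with ∈-map⁻ suc x∈
... | y , y∈ , refl = elems-∈ (f ∘ suc) y∈
elems-∈ {suc n} f x∈ | false with ∈-map⁻ suc x∈
... | y , y∈ , refl = elems-∈ (f ∘ suc) y∈

-- Covers of cuts

module Cuts (G : Graph) (t : ℕ) (noKtt : ¬ ContainsKtt t G) where

  V : Set
  V = Fin (n G)

  Adj : V → V → Set
  Adj u v = adj G u v ≡ true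

  Adj-sym : ∀ {u v} → Adj u v → Adj v u
  Adj-sym {u} {v} e = trans (≡.sym (Graph.sym G u v)) e

  part nbr : (P : Partition (n G)) → Fin (k P) → FinSet (n G)
  part P c x = ⌊ lab P x ≟ c ⌋
  nbr  P c v = ⌊ all? (λ x → (lab P x ≟ c) →-dec (adj G v x 𝔹.≟ true)) ⌋

  Big : (P : Partition (n G)) → Fin (k P) → Set
  Big P c = t ≤ card (part P c)

  Red : (P : Partition (n G)) → Fin (k P) → Fin (k P) → Set
  Red P c d = red G P c d ≡ true

  big? : ∀ P c → Dec (Big P c)
  big? P c = t ≤? card (part P c)

  red? : ∀ P c d → Dec (Red P c d)
  red? P c d = red G P c d 𝔹.≟ true

  rep : ∀ P → Fin (k P) → V
  rep P c = proj₁ (surj P c)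

  lab-rep : ∀ P c → lab P (rep P c) ≡ c
  lab-rep P c = proj₂ (surj P c)

  nbr-elim : ∀ P {c v} → nbr P c v ≡ true → ∀ {x} → lab P x ≡ c → Adj v x
  nbr-elim P p {x} e = ⌊⌋-elim {d = all? _} p x e

  nbr-intro : ∀ P {c v} → (∀ x → lab P x ≡ c → Adj v x) → nbr P c v ≡ true
  nbr-intro P h = ⌊⌋-intro {d = all? _} h

  -- Otherwise `t` vertices of the part and `t` of its common neighbours would form the forbidden
  -- subgraph; they are disjoint because no vertex is adjacent to itself.
  card-nbr : ∀ P c → Big P c → card (nbr P c) ≤ t
  card-nbr P c big with t ≤? card (nbr P c)
  ... | no  small = ≰⇒≥ small
  ... | yes large with choose (part P c) t big | choose (nbr P c) t large
  ...   | f , f-inj , f∈ | g , g-inj , g∈ =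
    ⊥-elim (noKtt (f , g , f-inj , g-inj , disjoint , λ i j → Adj-sym (adjacent i j)))
    where
    adjacent : ∀ i j → Adj (g j) (f i)
    adjacent i j = nbr-elim P (g∈ j) (⌊⌋-elim {d = lab P (f i) ≟ c} (f∈ i))
    disjoint : ∀ i j → f i ≢ g j
    disjoint i j e = true≢false (subst (λ x → Adj (g j) x) e (adjacent i j)) (loopless G (g j))

  red-intro : ∀ P {c d u v u′ v′} → c ≢ d → lab P u ≡ c → lab P v ≡ d → Adj u v →
    lab P u′ ≡ c → lab P v′ ≡ d → adj G u′ v′ ≡ false → Red P c d
  red-intro P {c} {d} {u} {v} {u′} {v′} c≢d lu lv e lu′ lv′ e′ =
    ∧-true differ (∧-true
      (anyF-intro _ u (anyF-intro _ v (∧-true (at u lu) (∧-true (at v lv) e))))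
      (anyF-intro _ u′ (anyF-intro _ v′ (∧-true (at u′ lu′) (∧-true (at v′ lv′) (not-true e′))))))
    where
    at : ∀ x {c} → lab P x ≡ c → ⌊ lab P x ≟ c ⌋ ≡ true
    at x {c} = ⌊⌋-intro {d = lab P x ≟ c}
    differ : not ⌊ c ≟ d ⌋ ≡ true
    differ with c ≟ d
    ... | yes p = ⊥-elim (c≢d p)
    ... | no  _ = refl

  record RedWitness (P : Partition (n G)) (c d : Fin (k P)) : Set where
    constructor red-witness
    field
      {u v u′ v′} : V
      lu  : lab P u ≡ c
      lv  : lab P v ≡ d
      edge : Adj u v
      lu′ : lab P u′ ≡ c
      lv′ : lab P v′ ≡ d
      non-edge : adj G u′ v′ ≡ false

  red-elim : ∀ P c d → Red P c d → c ≢ d × RedWitness P c d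
  red-elim P c d r with ∧-split r
  ... | differ , r₁ with ∧-split r₁
  ...   | r₂ , r₃ with anyF-elim _ r₂ | anyF-elim _ r₃
  ...     | u , p | u′ , p′ with anyF-elim _ p | anyF-elim _ p′
  ...       | v , q | v′ , q′ with ∧-split q | ∧-split q′
  ...         | a , q₁ | a′ , q₁′ with ∧-split q₁ | ∧-split q₁′
  ...           | b , e | b′ , e′ = c≢d , red-witness
                    (⌊⌋-elim {d = lab P u ≟ c} a) (⌊⌋-elim {d = lab P v ≟ d} b) e
                    (⌊⌋-elim {d = lab P u′ ≟ c} a′) (⌊⌋-elim {d = lab P v′ ≟ d} b′) (not-split e′)
    where
    c≢d : c ≢ d
    c≢d e = true≢false (⌊⌋-intro {d = c ≟ d} e) (not-split differ)

  red-sym : ∀ P c d → Red P c d → Red P d c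
  red-sym P c d r with red-elim P c d r
  ... | c≢d , red-witness lu lv e lu′ lv′ e′ =
    red-intro P (c≢d ∘ ≡.sym) lv lu (Adj-sym e) lv′ lu′ (trans (Graph.sym G _ _) e′)

  -- A vertex of the part of `v` not adjacent to `u` would, together with the edge, make the two
  -- parts red. Black edges at a big part are thus charged to its few common neighbours.
  homogeneous : ∀ P {u v} → lab P u ≢ lab P v → ¬ Red P (lab P u) (lab P v) → Adj u v →
    nbr P (lab P v) u ≡ true
  homogeneous P {u} {v} u≁v ¬red e = nbr-intro P λ x lx → case bool-cases (adj G u x) of λ where
    (inj₁ p) → p
    (inj₂ p) → ⊥-elim (¬red (red-intro P u≁v refl refl e refl lx p))

  -- An item of a cover: a set paid for once and for all, or a pair of big parts between which nothing is
  -- decided yet; the latter also contributes the common neighbours of its two parts.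
  data Item (P : Partition (n G)) : Set where
    frozen  : (S : FinSet (n G)) → card S ≤ 3 * t → Item P
    pending : (x y : V) → Big P (lab P x) → Big P (lab P y) → Item P

  halo : (P : Partition (n G)) → V → V → FinSet (n G)
  halo P x y = nbr P (lab P x) ∪ nbr P (lab P y)

  -- Parts are named by vertices inside them: the type `V` is common to all partitions, whereas the
  -- label types differ. The pair is unordered because either part may lie on the `L` side.
  Joins : (P : Partition (n G)) → V → V → V → V → Set
  Joins P x y u v = (lab P x ≡ lab P u × lab P y ≡ lab P v) ⊎ (lab P x ≡ lab P v × lab P y ≡ lab P u)

  Covers : (P : Partition (n G)) → Item P → V → V → Set
  Covers P (frozen S _)      u v = S u ≡ true ⊎ S v ≡ true
  Covers P (pending x y _ _) u v = (halo P x y u ≡ true ⊎ halo P x y v ≡ true) ⊎ Joins P x y u v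

  Pends : (P : Partition (n G)) → Item P → V → V → Set
  Pends P (frozen _ _)      u v = ⊥
  Pends P (pending x y _ _) u v = Joins P x y u v

  Joins-swap : ∀ P {x y u v} → Joins P x y u v → Joins P x y v u
  Joins-swap P = [ inj₂ , inj₁ ]′

  Joins-flip : ∀ P {x y u v} → Joins P x y u v → Joins P y x u v
  Joins-flip P (inj₁ (p , q)) = inj₂ (q , p)
  Joins-flip P (inj₂ (p , q)) = inj₁ (q , p)

  Covers-swap : ∀ P i {u v} → Covers P i u v → Covers P i v u
  Covers-swap P (frozen S _) c = swap c
  Covers-swap P (pending x y _ _) (inj₁ h) = inj₁ (swap h)
  Covers-swap P (pending x y _ _) (inj₂ j) = inj₂ (Joins-swap P j)

  Pends-swap : ∀ P i {u v} → Pends P i u v → Pends P i v u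
  Pends-swap P (pending x y _ _) j = Joins-swap P j

  -- A new cut consists of at most 4 parts (two halves and two doubled parts), each needing one item for
  -- itself and one per red neighbour: hence 12.
  record Good (P : Partition (n G)) (L : FinSet (n G)) : Set where
    field
      items   : List (Item P)
      few     : length items ≤ 12
      covered : ∀ u v → L u ≡ true → L v ≡ false → Adj u v → Any (λ i → Covers P i u v) items
      pended  : ∀ x y → L x ≡ true → L y ≡ false → Big P (lab P x) → Big P (lab P y) →
                Red P (lab P x) (lab P y) → Any (λ i → Pends P i x y) items

  Saturated : Partition (n G) → FinSet (n G) → Set
  Saturated P L = ∀ x y → lab P x ≡ lab P y → L x ≡ L y

  -- Inner nodes alone carry a cover: for singletons a leaf holds at most one vertex and is never a
  -- balanced cut. That the children cover their node is the relation used by the averaging in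
  -- `balance`.
  data Tree (P : Partition (n G)) : FinSet (n G) → Set where
    leaf : ∀ {L} → Saturated P L → (∀ x y → L x ≡ true → L y ≡ true → lab P x ≡ lab P y) → Tree P L
    node : ∀ {L L₁ L₂} → Saturated P L → Good P L →
           (∀ x → L x ≡ true → L₁ x ≡ true ⊎ L₂ x ≡ true) → Tree P L₁ → Tree P L₂ → Tree P L

-- Cuts that are unions of at most four parts

module Fresh (G : Graph) (t : ℕ) (noKtt : ¬ ContainsKtt t G)
             (P : Partition (n G)) (deg : RedBounded G 2 P) where
  open Cuts G t noKtt

  -- A small neighbour is frozen outright for fewer than `t` vertices, so only pairs of big parts
  -- stay pending. The decision is an argument so that proofs can match on it.
  redItem′ : ∀ c d → Big P c → Dec (Big P d) → Item P
  redItem′ c d big (yes big′) = pending (rep P c) (rep P d)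
    (subst (Big P) (≡.sym (lab-rep P c)) big) (subst (Big P) (≡.sym (lab-rep P d)) big′)
  redItem′ c d big (no small) = frozen (part P d) (≤-trans (≰⇒≥ small) (m≤n*m t 3))

  redItem : ∀ c → Big P c → Fin (k P) → Item P
  redItem c big d = redItem′ c d big (big? P d)

  itemsAt′ : ∀ c → Dec (Big P c) → List (Item P)
  itemsAt′ c (no small) = frozen (part P c) (≤-trans (≰⇒≥ small) (m≤n*m t 3)) ∷ []
  itemsAt′ c (yes big)  =
    frozen (nbr P c) (≤-trans (card-nbr P c big) (m≤n*m t 3)) ∷ map (redItem c big) (elems (red G P c))

  itemsAt : Fin (k P) → List (Item P)
  itemsAt c = itemsAt′ c (big? P c)

  card-red : ∀ c → card (red G P c) ≤ 2
  card-red c = subst (_≤ 2) (card-tabulate (red G P c)) (deg c)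

  length-itemsAt′ : ∀ c d → length (itemsAt′ c d) ≤ 3
  length-itemsAt′ c (no _)    = s≤s z≤n
  length-itemsAt′ c (yes big) = s≤s (subst (_≤ 2)
    (≡.sym (trans (length-map (redItem c big) (elems (red G P c))) (length-elems (red G P c)))) (card-red c))

  redItem-covers : ∀ {u v} big d → Covers P (redItem′ (lab P u) (lab P v) big d) u v
  redItem-covers {u} {v} big (yes _) = inj₂ (inj₁ (lab-rep P (lab P u) , lab-rep P (lab P v)))
  redItem-covers {u} {v} big (no _)  = inj₂ (⌊⌋-intro {d = lab P v ≟ lab P v} refl)

  redItem-pends : ∀ {u v} big d → Big P (lab P v) → Pends P (redItem′ (lab P u) (lab P v) big d) u v
  redItem-pends {u} {v} big (yes _) _ = inj₁ (lab-rep P (lab P u) , lab-rep P (lab P v))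
  redItem-pends big (no small) big′ = ⊥-elim (small big′)

  -- An edge leaving a small part meets that part. An edge leaving a big part ends in one of its
  -- common neighbours unless the two parts are red, and each red neighbour has its own item.
  itemsAt-covers : ∀ {u v} d → lab P u ≢ lab P v → Adj u v →
    Any (λ i → Covers P i u v) (itemsAt′ (lab P u) d)
  itemsAt-covers {u} {v} (no _) _ _ = here (inj₁ (⌊⌋-intro {d = lab P u ≟ lab P u} refl))
  itemsAt-covers {u} {v} (yes big) u≁v e with red? P (lab P v) (lab P u)
  ... | no ¬r = here (inj₂ (homogeneous P (u≁v ∘ ≡.sym) ¬r (Adj-sym e)))
  ... | yes r = there (Any.map⁺ (Any.map (λ { refl → redItem-covers big (big? P (lab P v)) })
                  (∈-elems (red G P (lab P u)) (lab P v) (red-sym P (lab P v) (lab P u) r))))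

  itemsAt-pends : ∀ {u v} d → Big P (lab P u) → Big P (lab P v) → Red P (lab P u) (lab P v) →
    Any (λ i → Pends P i u v) (itemsAt′ (lab P u) d)
  itemsAt-pends (no small) big _ _ = ⊥-elim (small big)
  itemsAt-pends {u} {v} (yes big) _ big′ r =
    there (Any.map⁺ (Any.map (λ { refl → redItem-pends big (big? P (lab P v)) big′ })
                  (∈-elems (red G P (lab P u)) (lab P v) r)))

  length-concatMap : ∀ cs → length (concatMap itemsAt cs) ≤ length cs * 3
  length-concatMap []       = z≤n
  length-concatMap (c ∷ cs) = ≤-trans (≤-reflexive (length-++ (itemsAt c)))
    (+-mono-≤ (length-itemsAt′ c (big? P c)) (length-concatMap cs))

  module _ (L : FinSet (n G)) (cs : List (Fin (k P))) (few : length cs ≤ 4)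
           (L⇒cs : ∀ x → L x ≡ true → lab P x ∈ˡ cs) (cs⇒L : ∀ x → lab P x ∈ˡ cs → L x ≡ true) where

    union-saturated : Saturated P L
    union-saturated x y e with bool-cases (L x) | bool-cases (L y)
    ... | inj₁ p | _ = trans p (≡.sym (cs⇒L y (subst (_∈ˡ cs) e (L⇒cs x p))))
    ... | inj₂ p | inj₂ q = trans p (≡.sym q)
    ... | inj₂ p | inj₁ q = true≢false (cs⇒L x (subst (_∈ˡ cs) (≡.sym e) (L⇒cs y q))) p

    differ : ∀ {u v} → L u ≡ true → L v ≡ false → lab P u ≢ lab P v
    differ {u} {v} p q e = true≢false (trans (≡.sym (union-saturated u v e)) p) q

    union-good : Good P L
    union-good = record
      { items   = concatMap itemsAt cs
      ; few     = ≤-trans (length-concatMap cs) (*-monoˡ-≤ 3 few)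
      ; covered = λ u v p q e → Any.concatMap⁺ itemsAt
          (Any.map (λ { refl → itemsAt-covers (big? P _) (differ p q) e }) (L⇒cs u p))
      ; pended  = λ x y p q bx by r → Any.concatMap⁺ itemsAt
          (Any.map (λ { refl → itemsAt-pends (big? P _) bx by r }) (L⇒cs x p))
      }

  -- A caterpillar cutting off one part at a time. Every remainder is again a union of at most four
  -- parts, so its cover is built afresh; the empty list ends in an empty leaf.
  comb : ∀ L cs → length cs ≤ 4 → (∀ x → L x ≡ true → lab P x ∈ˡ cs) →
    (∀ x → lab P x ∈ˡ cs → L x ≡ true) → Tree P L
  comb L [] few L⇒cs cs⇒L = leaf (union-saturated L [] few L⇒cs cs⇒L) λ x _ p _ → case L⇒cs x p of λ ()
  comb L (c ∷ cs) few L⇒cs cs⇒L = node {L₁ = part P c} {L₂ = L₂}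
      (union-saturated L (c ∷ cs) few L⇒cs cs⇒L) (union-good L (c ∷ cs) few L⇒cs cs⇒L)
      (λ x p → split x (L⇒cs x p))
      (leaf (λ { x y e → cong (λ d → ⌊ d ≟ c ⌋) e })
            (λ x y p q → trans (⌊⌋-elim {d = lab P x ≟ c} p) (≡.sym (⌊⌋-elim {d = lab P y ≟ c} q))))
      (comb L₂ cs (≤-trans (n≤1+n _) few)
        (λ x → ⌊⌋-elim {d = lab P x ∈? cs}) (λ x → ⌊⌋-intro {d = lab P x ∈? cs}))
    where
    L₂ : FinSet (n G)
    L₂ x = ⌊ lab P x ∈? cs ⌋
    split : ∀ x → lab P x ∈ˡ c ∷ cs → part P c x ≡ true ⊎ L₂ x ≡ true
    split x (here e)  = inj₁ (⌊⌋-intro {d = lab P x ≟ c} e)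
    split x (there m) = inj₂ (⌊⌋-intro {d = lab P x ∈? cs} m)

-- Splitting one part

module Split (G : Graph) (t : ℕ) (noKtt : ¬ ContainsKtt t G)
             (P P′ : Partition (n G)) (merge : Merge P P′) (deg : RedBounded G 2 P) where
  open Cuts G t noKtt
  open Fresh G t noKtt P deg using (comb; card-red)

  -- `P′` is the coarser partition: read backwards, the step splits the part of `a₁` in `P′` into
  -- the parts of `a₁` and `a₂` in `P`.
  a₁ a₂ : V
  a₁ = rep P (proj₁ merge)
  a₂ = rep P (proj₁ (proj₂ merge))

  infix 4 _∼_ _≈_
  _∼_ _≈_ : V → V → Set
  x ∼ y = lab P  x ≡ lab P  y
  x ≈ y = lab P′ x ≡ lab P′ y

  merged : ∀ x y → x ≈ y → x ∼ y ⊎ (x ∼ a₁ × y ∼ a₂) ⊎ (x ∼ a₂ × y ∼ a₁)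
  merged x y e with Equivalence.to (proj₂ (proj₂ (proj₂ merge)) x y) e
  ... | inj₁ p = inj₁ p
  ... | inj₂ (inj₁ (p , q)) = inj₂ (inj₁ (trans p (≡.sym (lab-rep P _)) , trans q (≡.sym (lab-rep P _))))
  ... | inj₂ (inj₂ (p , q)) = inj₂ (inj₂ (trans p (≡.sym (lab-rep P _)) , trans q (≡.sym (lab-rep P _))))

  a₁≁a₂ : ¬ a₁ ∼ a₂
  a₁≁a₂ e = proj₁ (proj₂ (proj₂ merge)) (trans (≡.sym (lab-rep P _)) (trans e (lab-rep P _)))

  coarsen : ∀ {x y} → x ∼ y → x ≈ y
  coarsen e = Equivalence.from (proj₂ (proj₂ (proj₂ merge)) _ _) (inj₁ e)

  a₂≈a₁ : a₂ ≈ a₁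
  a₂≈a₁ = Equivalence.from (proj₂ (proj₂ (proj₂ merge)) _ _) (inj₂ (inj₂ (lab-rep P _ , lab-rep P _)))

  halves : ∀ {x} → x ≈ a₁ → x ∼ a₁ ⊎ x ∼ a₂
  halves {x} e with merged x a₁ e
  ... | inj₁ p = inj₁ p
  ... | inj₂ (inj₁ (_ , q)) = ⊥-elim (a₁≁a₂ q)
  ... | inj₂ (inj₂ (p , _)) = inj₂ p

  rigid : ∀ {x y} → ¬ x ≈ a₁ → x ≈ y → x ∼ y
  rigid {x} {y} x≉a e with merged x y e
  ... | inj₁ p = p
  ... | inj₂ (inj₁ (p , _)) = ⊥-elim (x≉a (coarsen p))
  ... | inj₂ (inj₂ (p , _)) = ⊥-elim (x≉a (trans (coarsen p) a₂≈a₁))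

  -- Shrinking a part can only enlarge its set of common neighbours, so what a halo covered before
  -- the split it covers afterwards.
  nbr-refine : ∀ y → nbr P′ (lab P′ y) ⊑ nbr P (lab P y)
  nbr-refine y v h = nbr-intro P λ z e → nbr-elim P′ h (coarsen e)

  nbr-coarsen : ∀ {y} → ¬ y ≈ a₁ → nbr P (lab P y) ⊑ nbr P′ (lab P′ y)
  nbr-coarsen y≉a v h = nbr-intro P′ λ z e → nbr-elim P h (≡.sym (rigid y≉a (≡.sym e)))

  big-coarsen : ∀ x → Big P (lab P x) → Big P′ (lab P′ x)
  big-coarsen x b = ≤-trans b (card-mono λ z p →
    ⌊⌋-intro {d = lab P′ z ≟ lab P′ x} (coarsen (⌊⌋-elim {d = lab P z ≟ lab P x} p)))

  big-refine : ∀ {x} → ¬ x ≈ a₁ → Big P′ (lab P′ x) → Big P (lab P x)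
  big-refine {x} x≉a b = ≤-trans b (card-mono λ z p →
    ⌊⌋-intro {d = lab P z ≟ lab P x} (≡.sym (rigid x≉a (≡.sym (⌊⌋-elim {d = lab P′ z ≟ lab P′ x} p)))))

  red-coarsen : ∀ {x y} → ¬ x ≈ y → Red P (lab P x) (lab P y) → Red P′ (lab P′ x) (lab P′ y)
  red-coarsen {x} {y} x≉y r with red-elim P (lab P x) (lab P y) r
  ... | _ , red-witness lu lv e lu′ lv′ e′ =
    red-intro P′ x≉y (coarsen lu) (coarsen lv) e (coarsen lu′) (coarsen lv′) e′

  -- The size of the split part is tested in `P′`, before the split, since that is when its pair
  -- with `c` is pending; either half may be small by now.
  doubled? : ∀ c → Dec (Red P (lab P a₁) c × Red P (lab P a₂) c × Big P c × Big P′ (lab P′ a₁))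
  doubled? c = red? P (lab P a₁) c ×-dec red? P (lab P a₂) c ×-dec big? P c ×-dec big? P′ (lab P′ a₁)

  doubled : FinSet (k P)
  doubled c = ⌊ doubled? c ⌋

  D : FinSet (n G)
  D x = doubled (lab P x)

  D-elim : ∀ {x} → D x ≡ true →
    Red P (lab P a₁) (lab P x) × Red P (lab P a₂) (lab P x) × Big P (lab P x) × Big P′ (lab P′ a₁)
  D-elim {x} = ⌊⌋-elim {d = doubled? (lab P x)}

  D-∼ : ∀ {x y} → x ∼ y → D x ≡ D y
  D-∼ = cong doubled

  D-avoids : ∀ {x} → D x ≡ true → ¬ x ≈ a₁
  D-avoids {x} d e with D-elim {x} d | halves e
  ... | r , _ | inj₁ p = proj₁ (red-elim P _ _ r) (≡.sym p)
  ... | _ , r , _ | inj₂ p = proj₁ (red-elim P _ _ r) (≡.sym p)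

  -- The two halves of the split part already exhaust the red degree of a doubled part.
  D-only-red : ∀ {x y} → D x ≡ true → ¬ y ≈ a₁ → ¬ Red P (lab P x) (lab P y)
  D-only-red {x} {y} d y≉a r with D-elim {x} d
  ... | r₁ , r₂ , _ = <⇒≱ (card-distinct₃ (red G P (lab P x))
          (red-sym P (lab P a₁) (lab P x) r₁) (red-sym P (lab P a₂) (lab P x) r₂) r a₁≁a₂
          (λ e → y≉a (≡.sym (coarsen e))) (λ e → y≉a (trans (≡.sym (coarsen e)) a₂≈a₁)))
        (card-red (lab P x))

  card-halo : ∀ {x y} → Big P′ (lab P′ x) → Big P′ (lab P′ y) → card (halo P′ x y) ≤ t + t
  card-halo {x} {y} bx by = ≤-trans (card-∪ (nbr P′ (lab P′ x)) (nbr P′ (lab P′ y)))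
    (+-mono-≤ (card-nbr P′ _ bx) (card-nbr P′ _ by))

  2t≤3t : t + t ≤ 3 * t
  2t≤3t = ≤-trans (+-monoʳ-≤ t (m≤m+n t 0)) (m≤n+m (2 * t) t)

  -- The contract for an item that takes over from the pair of the split part and `y`. If `y` is
  -- doubled, only the halo is promised: `y` then follows `a₁`, and no cut separates the two any
  -- more.
  record Replaces (y : V) (i : Item P) : Set where
    field
      halo-covers : ∀ u v → halo P′ a₁ y u ≡ true → Covers P i u v
      pair-covers : D y ≡ false → ∀ u v → u ≈ a₁ → v ∼ y → Adj u v → Covers P i u v
      pends       : D y ≡ false → ∀ z → z ≈ a₁ → Red P (lab P z) (lab P y) → Big P (lab P z) → Pends P i z y

  module _ (y : V) (y≉a : ¬ y ≈ a₁) (big-a : Big P′ (lab P′ a₁)) (big-y : Big P′ (lab P′ y)) where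

    -- The half b is homogeneous to y, so only the half a can stay pending.
    keep-half : ∀ a b → a ≈ a₁ → (∀ z → z ≈ a₁ → z ∼ a ⊎ z ∼ b) → ¬ Red P (lab P b) (lab P y) →
      Σ (Item P) (Replaces y)
    keep-half a b a≈a cases ¬r with big? P (lab P a)
    ... | yes big = pending a y big (big-refine y≉a big-y) , record
      { halo-covers = λ u v h → inj₁ (inj₁ (refine-halo u h))
      ; pair-covers = λ _ u v u≈a v∼y e → pair u v (cases u u≈a) u≈a v∼y e
      ; pends       = λ _ z z≈a r _ → pend z (cases z z≈a) r
      }
      where
      refine-halo : halo P′ a₁ y ⊑ halo P a y
      refine-halo u h = case ∨-split h of λ where
        (inj₁ p) → ∨-trueˡ (nbr-refine a u (subst (λ c → nbr P′ c u ≡ true) (≡.sym a≈a) p))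
        (inj₂ p) → ∨-trueʳ {nbr P (lab P a) u} (nbr-refine y u p)
      pair : ∀ u v → u ∼ a ⊎ u ∼ b → u ≈ a₁ → v ∼ y → Adj u v →
        (halo P a y u ≡ true ⊎ halo P a y v ≡ true) ⊎ Joins P a y u v
      pair u v (inj₁ u∼a) _ v∼y _ = inj₂ (inj₁ (≡.sym u∼a , ≡.sym v∼y))
      pair u v (inj₂ u∼b) u≈a v∼y e = inj₁ (inj₁ (∨-trueʳ {nbr P (lab P a) u}
        (subst (λ c → nbr P c u ≡ true) v∼y (homogeneous P
          (λ u∼v → y≉a (trans (≡.sym (coarsen (trans u∼v v∼y))) u≈a))
          (λ r → ¬r (subst₂ (Red P) u∼b v∼y r)) e))))
      pend : ∀ z → z ∼ a ⊎ z ∼ b → Red P (lab P z) (lab P y) → Joins P a y z y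
      pend z (inj₁ z∼a) r = inj₁ (≡.sym z∼a , refl)
      pend z (inj₂ z∼b) r = ⊥-elim (¬r (subst (λ c → Red P c (lab P y)) z∼b r))
    ... | no small = frozen S S-small , record
      { halo-covers = λ u v h → inj₁ (∨-trueˡ h)
      ; pair-covers = λ _ u v u≈a v∼y e → inj₁ (pair u v (cases u u≈a) u≈a v∼y e)
      ; pends       = λ _ z z≈a r big → pend z (cases z z≈a) r big
      }
      where
      S : FinSet (n G)
      -- Two sets of common neighbours and a half that is no longer big: this sum accounts for the
      -- bound `3 * t` in `frozen`.
      S = halo P′ a₁ y ∪ part P (lab P a)
      S-small : card S ≤ 3 * t
      S-small = begin
        card S                                          ≤⟨ card-∪ (halo P′ a₁ y) (part P (lab P a)) ⟩
        card (halo P′ a₁ y) + card (part P (lab P a))   ≤⟨ +-mono-≤ (card-halo {a₁} {y} big-a big-y) (≰⇒≥ small) ⟩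
        t + t + t                                       ≡⟨ 3t t ⟩
        3 * t                                           ∎
        where
        open ≤-Reasoning
        3t : ∀ t → t + t + t ≡ 3 * t
        3t = solve-∀
      pair : ∀ u v → u ∼ a ⊎ u ∼ b → u ≈ a₁ → v ∼ y → Adj u v → S u ≡ true
      pair u v (inj₁ u∼a) _ v∼y _ = ∨-trueʳ {halo P′ a₁ y u} (⌊⌋-intro {d = lab P u ≟ lab P a} u∼a)
      pair u v (inj₂ u∼b) u≈a v∼y e = ∨-trueˡ (∨-trueʳ {nbr P′ (lab P′ a₁) u} (nbr-coarsen y≉a u
        (subst (λ c → nbr P c u ≡ true) v∼y (homogeneous P
          (λ u∼v → y≉a (trans (≡.sym (coarsen (trans u∼v v∼y))) u≈a))
          (λ r → ¬r (subst₂ (Red P) u∼b v∼y r)) e))))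
      pend : ∀ z → z ∼ a ⊎ z ∼ b → Red P (lab P z) (lab P y) → Big P (lab P z) → ⊥
      pend z (inj₁ z∼a) _ big = small (subst (Big P) z∼a big)
      pend z (inj₂ z∼b) r _   = ¬r (subst (λ c → Red P c (lab P y)) z∼b r)

    replace : Σ (Item P) (Replaces y)
    replace with bool-cases (D y) | red? P (lab P a₁) (lab P y) | red? P (lab P a₂) (lab P y)
    ... | inj₁ d | _ | _ = frozen (halo P′ a₁ y) (≤-trans (card-halo {a₁} {y} big-a big-y) 2t≤3t) , record
      { halo-covers = λ u v h → inj₁ h
      ; pair-covers = λ d′ → true≢false d d′
      ; pends       = λ d′ → true≢false d d′
      }
    ... | inj₂ _ | _ | no ¬r = keep-half a₁ a₂ refl (λ z → halves) ¬r
    ... | inj₂ _ | no ¬r | yes _ = keep-half a₂ a₁ a₂≈a₁ (λ z → swap ∘ halves) ¬r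
    -- Red to both halves, with both parts big, means that `y` is doubled after all.
    ... | inj₂ d | yes r₁ | yes r₂ =
      true≢false (⌊⌋-intro {d = doubled? (lab P y)} (r₁ , r₂ , big-refine y≉a big-y , big-a)) d

  -- What is known of two vertices on opposite sides of a cut after the doubled parts have moved next to the split part.
  record Separable (u v : V) : Set where
    constructor separable
    field
      not-both : ¬ (u ≈ a₁ × v ≈ a₁)
      right    : u ≈ a₁ → D v ≡ false
      left     : v ≈ a₁ → D u ≡ false

  flip-sep : ∀ {u v} → Separable u v → Separable v u
  flip-sep (separable nb r l) = separable (λ (p , q) → nb (q , p)) l r

  -- `moved` is for doubled parts that change sides: an item pending between `a₁` and such a `y`
  -- must now absorb all edges at common neighbours of `y`, since these may start to cross.
  record Step (i : Item P′) (i′ : Item P) : Set where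
    field
      covers : ∀ u v → Separable u v → Adj u v → Covers P′ i u v → Covers P i′ u v
      pends  : ∀ x y → Separable x y → Big P (lab P x) → Big P (lab P y) →
               Red P (lab P x) (lab P y) → Pends P′ i x y → Pends P i′ x y
      moved  : ∀ y v → D y ≡ true → Pends P′ i a₁ y → nbr P (lab P y) v ≡ true → ∀ u → Covers P i′ v u

  step-half : ∀ x y bx by → x ≈ a₁ → ¬ y ≈ a₁ → Σ (Item P) (Step (pending x y bx by))
  step-half x y bx by x≈a y≉a with replace y y≉a (subst (Big P′) x≈a bx) by
  ... | i , rep = i , record
    { covers = λ u v s e → λ where
        (inj₁ (inj₁ h)) → halo-covers u v (at-a u h)
        (inj₁ (inj₂ h)) → Covers-swap P i (halo-covers v u (at-a v h))
        (inj₂ (inj₁ (x≈u , y≈v))) → join u v s e x≈u y≈v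
        (inj₂ (inj₂ (x≈v , y≈u))) → Covers-swap P i (join v u (flip-sep s) (Adj-sym e) x≈v y≈u)
    ; pends = λ where
        u v s bu bv r (inj₁ (x≈u , y≈v)) → pend u v s bu r x≈u y≈v
        u v s bu bv r (inj₂ (x≈v , y≈u)) →
          Pends-swap P i (pend v u (flip-sep s) bv (red-sym P (lab P u) (lab P v) r) x≈v y≈u)
    ; moved = λ where
        z v d (inj₁ (_ , y≈z)) h u → halo-covers v u (∨-trueʳ {nbr P′ (lab P′ a₁) v}
          (nbr-coarsen y≉a v (subst (λ c → nbr P c v ≡ true) (≡.sym (rigid y≉a y≈z)) h)))
        z v d (inj₂ (_ , y≈a)) → ⊥-elim (y≉a y≈a)
    }
    where
    open Replaces rep renaming (pends to rep-pends)
    at-a : ∀ u → halo P′ x y u ≡ true → halo P′ a₁ y u ≡ true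
    at-a u = subst (λ c → nbr P′ c u ∨ nbr P′ (lab P′ y) u ≡ true) x≈a
    join : ∀ u v → Separable u v → Adj u v → x ≈ u → y ≈ v → Covers P i u v
    join u v s e x≈u y≈v = pair-covers
      (trans (D-∼ (rigid y≉a y≈v)) (Separable.right s (trans (≡.sym x≈u) x≈a)))
      u v (trans (≡.sym x≈u) x≈a) (≡.sym (rigid y≉a y≈v)) e
    pend : ∀ u v → Separable u v → Big P (lab P u) → Red P (lab P u) (lab P v) → x ≈ u → y ≈ v → Pends P i u v
    pend u v s bu r x≈u y≈v = pends-∼ i (rep-pends
        (trans (D-∼ y∼v) (Separable.right s u≈a)) u u≈a (subst (Red P (lab P u)) (≡.sym y∼v) r) bu)
      where
      u≈a : u ≈ a₁
      u≈a = trans (≡.sym x≈u) x≈a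
      y∼v : y ∼ v
      y∼v = rigid y≉a y≈v
      pends-∼ : ∀ i → Pends P i u y → Pends P i u v
      pends-∼ (pending _ _ _ _) (inj₁ (p , q)) = inj₁ (p , trans q y∼v)
      pends-∼ (pending _ _ _ _) (inj₂ (p , q)) = inj₂ (trans p y∼v , q)

  step-flip : ∀ {x y bx by i} → Step (pending y x by bx) i → Step (pending x y bx by) i
  step-flip {x} {y} s = record
    { covers = λ where
        u v p e (inj₁ h) → Step.covers s u v p e (inj₁ ([ inj₁ ∘ flip-halo u , inj₂ ∘ flip-halo v ]′ h))
        u v p e (inj₂ j) → Step.covers s u v p e (inj₂ (Joins-flip P′ j))
    ; pends = λ u v p bu bv r j → Step.pends s u v p bu bv r (Joins-flip P′ j)
    ; moved = λ z v d j → Step.moved s z v d (Joins-flip P′ j)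
    }
    where
    flip-halo : halo P′ x y ⊑ halo P′ y x
    flip-halo u h = [ ∨-trueʳ {nbr P′ (lab P′ y) u} , ∨-trueˡ ]′ (∨-split h)

  -- Each item becomes exactly one item, so covers keep their length through every split.
  advance : ∀ i → Σ (Item P) (Step i)
  advance (frozen S small) = frozen S small , record
    { covers = λ u v _ _ c → c ; pends = λ _ _ _ _ _ _ () ; moved = λ _ _ _ () }
  advance (pending x y bx by) with lab P′ x ≟ lab P′ a₁ | lab P′ y ≟ lab P′ a₁
  ... | yes x≈a | no y≉a = step-half x y bx by x≈a y≉a
  ... | no x≉a | yes y≈a with step-half y x by bx y≈a x≉a
  ...   | i , s = i , step-flip s
  -- Both ends lie in the split part, which no old cut divides, so only the halo has to be kept.
  advance (pending x y bx by) | yes x≈a | yes y≈a =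
    frozen (halo P′ x y) (≤-trans (card-halo {x} {y} bx by) 2t≤3t) , record
    { covers = λ where
        u v s e (inj₁ h) → h
        u v s e (inj₂ j) → ⊥-elim (Separable.not-both s (within j))
    ; pends = λ u v s _ _ _ j → Separable.not-both s (within j)
    ; moved = λ z v d j → ⊥-elim (D-avoids d (proj₂ (within j)))
    }
    where
    within : ∀ {u v} → Joins P′ x y u v → u ≈ a₁ × v ≈ a₁
    within (inj₁ (p , q)) = trans (≡.sym p) x≈a , trans (≡.sym q) y≈a
    within (inj₂ (p , q)) = trans (≡.sym q) y≈a , trans (≡.sym p) x≈a
  advance (pending x y bx by) | no x≉a | no y≉a =
    pending x y (big-refine x≉a bx) (big-refine y≉a by) , record
    { covers = λ where
        u v s e (inj₁ h) → inj₁ ([ inj₁ ∘ refine-halo u , inj₂ ∘ refine-halo v ]′ h)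
        u v s e (inj₂ j) → inj₂ (refine-joins j)
    ; pends = λ u v s _ _ _ j → refine-joins j
    ; moved = λ where
        z v d (inj₁ (p , q)) → ⊥-elim (x≉a p)
        z v d (inj₂ (p , q)) → ⊥-elim (y≉a q)
    }
    where
    refine-halo : halo P′ x y ⊑ halo P x y
    refine-halo u h = [ (λ p → ∨-trueˡ (nbr-refine x u p)) ,
                        (λ p → ∨-trueʳ {nbr P (lab P x) u} (nbr-refine y u p)) ]′ (∨-split h)
    refine-joins : ∀ {u v} → Joins P′ x y u v → Joins P x y u v
    refine-joins (inj₁ (p , q)) = inj₁ (rigid x≉a p , rigid y≉a q)
    refine-joins (inj₂ (p , q)) = inj₂ (rigid x≉a p , rigid y≉a q)

-- Moving the doubled parts in every cut

module SplitTree (G : Graph) (t : ℕ) (noKtt : ¬ ContainsKtt t G)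
             (P P′ : Partition (n G)) (merge : Merge P P′) (deg : RedBounded G 2 P) where
  open Cuts G t noKtt
  open Fresh G t noKtt P deg using (comb; card-red)
  open Split G t noKtt P P′ merge deg

  -- Applied at every node, this relocates the doubled leaves at once: in each cut they join the
  -- side that holds the split part.
  move : FinSet (n G) → FinSet (n G)
  move L x = if D x then L a₁ else L x

  move-D : ∀ L {x} → D x ≡ true → move L x ≡ L a₁
  move-D L d rewrite d = refl

  move-¬D : ∀ L {x} → D x ≡ false → move L x ≡ L x
  move-¬D L d rewrite d = refl

  move-saturated : ∀ {L} → Saturated P′ L → Saturated P (move L)
  move-saturated {L} sat x y e with bool-cases (D y)
  ... | inj₁ d = trans (move-D L (trans (D-∼ e) d)) (≡.sym (move-D L d))
  ... | inj₂ d = trans (move-¬D L (trans (D-∼ e) d)) (trans (sat x y (coarsen e)) (≡.sym (move-¬D L d)))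

  module _ {L : FinSet (n G)} (sat : Saturated P′ L) (good : Good P′ L) where
    open Good good

    crossing-separable : ∀ {u v} → L u ≡ true → L v ≡ false →
      (u ≈ a₁ → D v ≡ false) → (v ≈ a₁ → D u ≡ false) → Separable u v
    crossing-separable p q = separable
      (λ (u≈a , v≈a) → true≢false (trans (≡.sym (sat _ _ (trans u≈a (≡.sym v≈a)))) p) q)

    items′ : List (Item P)
    items′ = map (proj₁ ∘ advance) items

    via : ∀ {A : Item P′ → Set} {B : Item P → Set} →
      (∀ i → A i → B (proj₁ (advance i))) → Any A items → Any B items′
    via f a = Any.map⁺ (Any.map (λ {i} → f i) a)

    old-covered : ∀ {u v} → Separable u v → L u ≡ true → L v ≡ false → Adj u v →
      Any (λ i → Covers P i u v) items′
    old-covered s p q e = via (λ i → Step.covers (proj₂ (advance i)) _ _ s e) (covered _ _ p q e)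

    a₁-red : ∀ {x} → D x ≡ true → Red P′ (lab P′ a₁) (lab P′ x)
    a₁-red d = red-coarsen (λ e → D-avoids d (≡.sym e)) (proj₁ (D-elim d))

    D-nbr : ∀ {x v} → D x ≡ true → D v ≡ false → ¬ v ≈ a₁ → Adj v x → nbr P (lab P x) v ≡ true
    D-nbr {x} {v} d d′ v≉a e = homogeneous P
      (λ v∼x → true≢false d (trans (≡.sym (D-∼ v∼x)) d′))
      (λ r → D-only-red d v≉a (red-sym P (lab P v) (lab P x) r)) e

    D-bigs : ∀ {x} → D x ≡ true → Big P′ (lab P′ a₁) × Big P′ (lab P′ x)
    D-bigs {x} d with D-elim {x} d
    ... | _ , _ , bx , ba = ba , big-coarsen x bx

    -- Only a doubled part that changes sides creates crossing edges; all other crossing edges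
    -- crossed before and stay with the successor of their item. Two doubled ends are never
    -- separated.
    covered′ : ∀ u v → move L u ≡ true → move L v ≡ false → Adj u v → Any (λ i → Covers P i u v) items′
    covered′ u v p q e with bool-cases (D u) | bool-cases (D v)
    ... | inj₁ du | inj₁ dv = true≢false (trans (≡.sym (move-D L du)) p) (trans (≡.sym (move-D L dv)) q)
    ... | inj₂ du | inj₂ dv = old-covered
            (crossing-separable (trans (≡.sym (move-¬D L du)) p) (trans (≡.sym (move-¬D L dv)) q)
              (λ _ → dv) (λ _ → du))
            (trans (≡.sym (move-¬D L du)) p) (trans (≡.sym (move-¬D L dv)) q) e
    ... | inj₁ du | inj₂ dv with bool-cases (L u)
    ...   | inj₁ Lu = old-covered (crossing-separable Lu Lv (λ _ → dv) (λ v≈a → ⊥-elim (v≉a v≈a))) Lu Lv e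
      where
      Lv = trans (≡.sym (move-¬D L dv)) q
      v≉a = λ v≈a → true≢false (trans (≡.sym (move-D L du)) p) (trans (≡.sym (sat _ _ v≈a)) Lv)
    -- `u` changes sides, so its red pair with `a₁` crossed the old cut and was pending. The
    -- successor of that item contains the common neighbours of `u`, and `v` is one of them.
    ...   | inj₂ Lu = via (λ i pd → Covers-swap P (proj₁ (advance i))
                  (Step.moved (proj₂ (advance i)) u v du pd (D-nbr du dv v≉a (Adj-sym e)) u))
              (pended a₁ u La Lu (proj₁ (D-bigs du)) (proj₂ (D-bigs du)) (a₁-red du))
      where
      La = trans (≡.sym (move-D L du)) p
      v≉a = λ v≈a → true≢false La (trans (≡.sym (sat _ _ v≈a)) (trans (≡.sym (move-¬D L dv)) q))
    covered′ u v p q e | inj₂ du | inj₁ dv with bool-cases (L v)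
    ...   | inj₂ Lv = old-covered (crossing-separable Lu Lv (λ u≈a → ⊥-elim (u≉a u≈a)) (λ _ → du)) Lu Lv e
      where
      Lu = trans (≡.sym (move-¬D L du)) p
      u≉a = λ u≈a → true≢false (trans (≡.sym (sat _ _ u≈a)) Lu) (trans (≡.sym (move-D L dv)) q)
    ...   | inj₁ Lv = via (λ i pd → Step.moved (proj₂ (advance i)) v u dv (Pends-swap P′ i pd)
                  (D-nbr dv du u≉a e) v)
              (pended v a₁ Lv La (proj₂ (D-bigs dv)) (proj₁ (D-bigs dv))
                (red-sym P′ (lab P′ a₁) (lab P′ v) (a₁-red dv)))
      where
      La = trans (≡.sym (move-D L dv)) q
      u≉a = λ u≈a → true≢false (trans (≡.sym (sat _ _ u≈a)) (trans (≡.sym (move-¬D L du)) p)) La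

    -- A doubled part is red only to the two halves, which now lie on its own side. A crossing red
    -- pair therefore avoids doubled parts and comes from a crossing red pair of `P′`.
    pended′ : ∀ x y → move L x ≡ true → move L y ≡ false → Big P (lab P x) → Big P (lab P y) →
      Red P (lab P x) (lab P y) → Any (λ i → Pends P i x y) items′
    pended′ x y p q bx by r with bool-cases (D x) | bool-cases (D y)
    ... | inj₁ dx | inj₁ dy = true≢false (trans (≡.sym (move-D L dx)) p) (trans (≡.sym (move-D L dy)) q)
    ... | inj₁ dx | inj₂ dy = ⊥-elim (D-only-red dx y≉a r)
      where
      y≉a = λ y≈a → true≢false (trans (≡.sym (move-D L dx)) p)
                      (trans (≡.sym (sat _ _ y≈a)) (trans (≡.sym (move-¬D L dy)) q))
    ... | inj₂ dx | inj₁ dy = ⊥-elim (D-only-red dy x≉a (red-sym P (lab P x) (lab P y) r))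
      where
      x≉a = λ x≈a → true≢false (trans (≡.sym (sat _ _ x≈a)) (trans (≡.sym (move-¬D L dx)) p))
                      (trans (≡.sym (move-D L dy)) q)
    ... | inj₂ dx | inj₂ dy =
      via (λ i → Step.pends (proj₂ (advance i)) x y
                   (crossing-separable Lx Ly (λ _ → dy) (λ _ → dx)) bx by r)
          (pended x y Lx Ly (big-coarsen x bx) (big-coarsen y by)
            (red-coarsen (λ x≈y → true≢false (trans (≡.sym (sat _ _ x≈y)) Lx) Ly) r))
      where
      Lx = trans (≡.sym (move-¬D L dx)) p
      Ly = trans (≡.sym (move-¬D L dy)) q

    move-good : Good P (move L)
    move-good = record
      { items   = items′
      ; few     = subst (_≤ 12) (≡.sym (length-map (proj₁ ∘ advance) items)) few
      ; covered = covered′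
      ; pended  = pended′
      }

  move-split : ∀ {L L₁ L₂} → (∀ x → L x ≡ true → L₁ x ≡ true ⊎ L₂ x ≡ true) →
    ∀ x → move L x ≡ true → move L₁ x ≡ true ⊎ move L₂ x ≡ true
  move-split split x p with D x
  ... | true  = split a₁ p
  ... | false = split x p

  -- A leaf without the split part can only lose vertices, namely those of a doubled part. The leaf
  -- with the split part gathers both halves and all doubled parts, and is expanded into a
  -- caterpillar.
  move-tree : ∀ {L} → Tree P′ L → Tree P (move L)
  move-tree (node sat good split T₁ T₂) =
    node (move-saturated sat) (move-good sat good) (move-split split) (move-tree T₁) (move-tree T₂)
  move-tree {L} (leaf sat one) with bool-cases (L a₁)
  ... | inj₂ La = leaf (move-saturated sat) λ x y p q →
          rigid (λ x≈a → true≢false (trans (≡.sym (sat _ _ x≈a)) (stays x p)) La) (one x y (stays x p) (stays y q))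
    where
    stays : ∀ x → move L x ≡ true → L x ≡ true
    stays x p with D x
    ... | true  = true≢false p La
    ... | false = p
  ... | inj₁ La = comb (move L) (lab P a₁ ∷ lab P a₂ ∷ elems doubled) (s≤s (s≤s few)) to from
    where
    -- Doubled parts are red neighbours of the half of `a₁`, so there are at most two, and at most
    -- four parts in all.
    few : length (elems doubled) ≤ 2
    few = begin
      length (elems doubled)      ≡⟨ length-elems doubled ⟩
      card doubled                ≤⟨ card-mono (λ c d → proj₁ (⌊⌋-elim {d = doubled? c} d)) ⟩
      card (red G P (lab P a₁))   ≤⟨ card-red (lab P a₁) ⟩
      2                           ∎
      where open ≤-Reasoning
    to : ∀ x → move L x ≡ true → lab P x ∈ˡ lab P a₁ ∷ lab P a₂ ∷ elems doubled
    to x p with bool-cases (D x)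
    ... | inj₁ d = there (there (∈-elems doubled (lab P x) d))
    ... | inj₂ d with halves (one x a₁ (trans (≡.sym (move-¬D L d)) p) La)
    ...   | inj₁ e = here e
    ...   | inj₂ e = there (here e)
    in-A : ∀ x → x ≈ a₁ → move L x ≡ true
    in-A x x≈a with bool-cases (D x)
    ... | inj₁ d = ⊥-elim (D-avoids d x≈a)
    ... | inj₂ d = trans (move-¬D L d) (trans (sat _ _ x≈a) La)
    from : ∀ x → lab P x ∈ˡ lab P a₁ ∷ lab P a₂ ∷ elems doubled → move L x ≡ true
    from x (here e)           = in-A x (coarsen e)
    from x (there (here e))   = in-A x (trans (coarsen e) a₂≈a₁)
    from x (there (there m))  = trans (move-D L (elems-∈ doubled m)) La

  move-full : ∀ {L} → (∀ x → L x ≡ true) → ∀ x → move L x ≡ true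
  move-full full x with D x
  ... | true  = full a₁
  ... | false = full x

-- Separators for the partition into singletons

module Separators (G : Graph) (t : ℕ) (noKtt : ¬ ContainsKtt t G) where
  open Cuts G t noKtt

  -- The sequence runs from fine to coarse, so the recursion first builds the tree of the coarser
  -- partition and then refines it by one split.
  tree : ∀ P → SeqFrom G 2 P → Σ[ L ∈ FinSet (n G) ] (∀ x → L x ≡ true) × Tree P L
  tree P (done _ trivial) = (λ _ → true) , (λ _ → refl) , leaf (λ _ _ _ → refl) λ x y _ _ → trivial x y
  tree P (step {P' = P′} deg merge rest) with tree P′ rest
  ... | L , full , T = move L , move-full full , move-tree T
    where open SplitTree G t noKtt P P′ merge deg

  Separates : FinSet (n G) → FinSet (n G) → Set
  Separates S L = ∀ u v → L u ≡ true → L v ≡ false → Adj u v → S u ≡ true ⊎ S v ≡ true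

  module _ (1≤t : 1 ≤ t) (P : Partition (n G)) (discrete : Discrete P) where

    -- Once parts are singletons, adding the single vertex of the part of `x` hits every edge of a
    -- pending pair; `1 ≤ t` fits it into the bound `3 * t`.
    itemSet : Item P → FinSet (n G)
    itemSet (frozen S _) = S
    itemSet (pending x y _ _) = halo P x y ∪ part P (lab P x)

    card-part : ∀ c → card (part P c) ≤ 1
    card-part c = card-subsingleton (part P c) λ x y p q →
      discrete (trans (⌊⌋-elim {d = lab P x ≟ c} p) (≡.sym (⌊⌋-elim {d = lab P y ≟ c} q)))

    card-itemSet : ∀ i → card (itemSet i) ≤ 3 * t
    card-itemSet (frozen S small) = small
    card-itemSet (pending x y bx by) = begin
      card (halo P x y ∪ part P (lab P x))
        ≤⟨ card-∪ (halo P x y) (part P (lab P x)) ⟩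
      card (halo P x y) + card (part P (lab P x))
        ≤⟨ +-mono-≤ (≤-trans (card-∪ (nbr P (lab P x)) (nbr P (lab P y)))
             (+-mono-≤ (card-nbr P _ bx) (card-nbr P _ by)))
             (≤-trans (card-part (lab P x)) 1≤t) ⟩
      t + t + t
        ≡⟨ 3t t ⟩
      3 * t ∎
      where
      open ≤-Reasoning
      3t : ∀ t → t + t + t ≡ 3 * t
      3t = solve-∀

    itemSet-covers : ∀ i {u v} → Covers P i u v → itemSet i u ≡ true ⊎ itemSet i v ≡ true
    itemSet-covers (frozen S _) c = c
    itemSet-covers (pending x y _ _) (inj₁ (inj₁ h)) = inj₁ (∨-trueˡ h)
    itemSet-covers (pending x y _ _) (inj₁ (inj₂ h)) = inj₂ (∨-trueˡ h)
    itemSet-covers (pending x y _ _) {u} {v} (inj₂ (inj₁ (e , _))) =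
      inj₁ (∨-trueʳ {halo P x y u} (⌊⌋-intro {d = lab P u ≟ lab P x} (≡.sym e)))
    itemSet-covers (pending x y _ _) {u} {v} (inj₂ (inj₂ (e , _))) =
      inj₂ (∨-trueʳ {halo P x y v} (⌊⌋-intro {d = lab P v ≟ lab P x} (≡.sym e)))

    union : List (Item P) → FinSet (n G)
    union []       = λ _ → false
    union (i ∷ is) = itemSet i ∪ union is

    card-union : ∀ is → card (union is) ≤ length is * (3 * t)
    card-union []       = ≤-reflexive (card-∅ (union []) λ _ → refl)
    card-union (i ∷ is) = ≤-trans (card-∪ (itemSet i) (union is)) (+-mono-≤ (card-itemSet i) (card-union is))

    union-covers : ∀ is {u v} → Any (λ i → Covers P i u v) is → union is u ≡ true ⊎ union is v ≡ true
    union-covers (i ∷ is) (here c) = [ inj₁ ∘ ∨-trueˡ , inj₂ ∘ ∨-trueˡ ]′ (itemSet-covers i c)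
    union-covers (i ∷ is) {u} {v} (there a) =
      [ inj₁ ∘ ∨-trueʳ {itemSet i u} , inj₂ ∘ ∨-trueʳ {itemSet i v} ]′ (union-covers is a)

    separator : ∀ {L} → Good P L → Σ[ S ∈ FinSet (n G) ] card S ≤ 12 * (3 * t) × Separates S L
    separator good = union items , ≤-trans (card-union items) (*-monoˡ-≤ (3 * t) few) ,
      λ u v p q e → union-covers items (covered u v p q e)
      where open Good good

-- Trees of bags

-- A tree grown by leaves: the new node hangs at `p` and takes index `zero`. Connectedness and
-- acyclicity thereby become inductions on the newest node.
data BagTree (N : ℕ) : ℕ → Set where
  root : FinSet N → BagTree N 0
  add  : ∀ {m} → BagTree N m → Fin (suc m) → FinSet N → BagTree N (suc m)

bagOf : ∀ {N m} → BagTree N m → Fin (suc m) → FinSet N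
bagOf (root b)    _       = b
bagOf (add T p b) zero    = b
bagOf (add T p b) (suc i) = bagOf T i

treeAdj : ∀ {N m} → BagTree N m → Fin (suc m) → Fin (suc m) → Bool
treeAdj (root b)    _       _       = false
treeAdj (add T p b) zero    zero    = false
treeAdj (add T p b) zero    (suc j) = ⌊ p ≟ j ⌋
treeAdj (add T p b) (suc i) zero    = ⌊ p ≟ i ⌋
treeAdj (add T p b) (suc i) (suc j) = treeAdj T i j

treeAdj-sym : ∀ {N m} (T : BagTree N m) i j → treeAdj T i j ≡ treeAdj T j i
treeAdj-sym (root b)    i       j       = refl
treeAdj-sym (add T p b) zero    zero    = refl
treeAdj-sym (add T p b) zero    (suc j) = refl
treeAdj-sym (add T p b) (suc i) zero    = refl
treeAdj-sym (add T p b) (suc i) (suc j) = treeAdj-sym T i j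

treeAdj-irrefl : ∀ {N m} (T : BagTree N m) i → treeAdj T i i ≡ false
treeAdj-irrefl (root b)    i       = refl
treeAdj-irrefl (add T p b) zero    = refl
treeAdj-irrefl (add T p b) (suc i) = treeAdj-irrefl T i

shape : ∀ {N m} → BagTree N m → Graph
shape {m = m} T = record
  { n = suc m ; adj = treeAdj T ; sym = treeAdj-sym T ; loopless = treeAdj-irrefl T }

walk-snoc : ∀ {G S x y z} → Walk G S x y → adj G y z ≡ true → S z → Walk G S x z
walk-snoc (nil sx)      e sz = cons sx e (nil sz)
walk-snoc (cons sx f w) e sz = cons sx f (walk-snoc w e sz)

walk-map : ∀ {G S S′ x y} → (∀ i → S i → S′ i) → Walk G S x y → Walk G S′ x y
walk-map h (nil sx)      = nil (h _ sx)
walk-map h (cons sx e w) = cons (h _ sx) e (walk-map h w)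

walk-add : ∀ {N m} {T : BagTree N m} {p b S x y} →
  Walk (shape T) (S ∘ suc) x y → Walk (shape (add T p b)) S (suc x) (suc y)
walk-add (nil sx)      = nil sx
walk-add (cons sx e w) = cons sx e (walk-add w)

-- Adding a node never disconnects S and never starts a second component of it.
Hereditary : ∀ {N m} → BagTree N m → (Fin (suc m) → Set) → Set
Hereditary (root b)    S = ⊤
Hereditary (add T p b) S = Hereditary T (S ∘ suc) × (S zero → S (suc p) ⊎ (∀ i → ¬ S (suc i)))

hereditary-connected : ∀ {N m} (T : BagTree N m) S → Hereditary T S → ConnectedOn (shape T) S
hereditary-connected (root b) S h zero zero sx sy = nil sx
hereditary-connected (add T p b) S (h , new) zero zero sx sy = nil sx
hereditary-connected (add T p b) S (h , new) (suc i) (suc j) sx sy =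
  walk-add (hereditary-connected T (S ∘ suc) h i j sx sy)
hereditary-connected (add T p b) S (h , new) zero (suc j) sx sy with new sx
... | inj₁ sp   = cons sx (⌊⌋-intro {d = p ≟ p} refl)
                    (walk-add (hereditary-connected T (S ∘ suc) h p j sp sy))
... | inj₂ none = ⊥-elim (none j sy)
hereditary-connected (add T p b) S (h , new) (suc i) zero sx sy with new sy
... | inj₁ sp   = walk-snoc (walk-add (hereditary-connected T (S ∘ suc) h i p sx sp))
                    (⌊⌋-intro {d = p ≟ p} refl) sy
... | inj₂ none = ⊥-elim (none i sx)

total-hereditary : ∀ {N m} (T : BagTree N m) → Hereditary T (λ _ → ⊤)
total-hereditary (root b)    = tt
total-hereditary (add T p b) = total-hereditary T , λ _ → inj₁ tt

cyclic-neighbours : ∀ {A : Set} (R : A → A → Set) → (∀ {x y} → R x y → R y x) →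
  ∀ {ℓ} (c : Fin (3 + ℓ) → A) → (∀ i → R (c (inject₁ i)) (c (suc i))) → R (c (fromℕ (2 + ℓ))) (c zero) →
  ∀ i → Σ[ j ∈ Fin (3 + ℓ) ] Σ[ l ∈ Fin (3 + ℓ) ] j ≢ l × R (c i) (c j) × R (c i) (c l)
cyclic-neighbours R R-sym c path close zero =
  suc zero , fromℕ _ , (λ ()) , path zero , R-sym close
cyclic-neighbours R R-sym c path close (suc i) with view i
... | ‵fromℕ = inject₁ (fromℕ _) , zero , (λ ()) , R-sym (path (fromℕ _)) , close
... | ‵inject₁ j = inject₁ (inject₁ j) , suc (suc j) , differ , R-sym (path (inject₁ j)) , path (suc j)
  where
  differ : inject₁ (inject₁ j) ≢ suc (suc j)
  differ e = 1+n≰n (≤-trans (n≤1+n _) (≤-reflexive (≡.sym (trans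
    (≡.sym (trans (toℕ-inject₁ (inject₁ j)) (toℕ-inject₁ j))) (cong toℕ e)))))

-- The newest node has its parent as only neighbour, whereas a vertex on a cycle has two; so a cycle
-- avoids it and lies in the older tree.
acyclic : ∀ {N m} (T : BagTree N m) → ¬ HasCycle (shape T)
acyclic (root b) (ℓ , c , inj , path , close) = true≢false close refl
acyclic (add T p b) (ℓ , c , inj , path , close) with any? (λ i → c i ≟ zero)
... | yes (i , ci≡0) with cyclic-neighbours (λ x y → treeAdj (add T p b) x y ≡ true)
                          (λ {x} {y} e → trans (treeAdj-sym (add T p b) y x) e) c path close i
...   | j , l , j≢l , ej , el = j≢l (inj (trans (is-parent j ej) (≡.sym (is-parent l el))))
  where
  is-parent : ∀ j → treeAdj (add T p b) (c i) (c j) ≡ true → c j ≡ suc p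
  is-parent j e with c j | subst (λ x → treeAdj (add T p b) x (c j) ≡ true) ci≡0 e
  ... | zero  | ()
  ... | suc q | e′ = cong suc (≡.sym (⌊⌋-elim {d = p ≟ q} e′))
acyclic (add T p b) (ℓ , c , inj , path , close) | no nowhere = acyclic T
  (ℓ , d , (λ {x} {y} e → inj (trans (c≡ x) (trans (cong suc e) (≡.sym (c≡ y))))) ,
   (λ i → below (inject₁ i) (suc i) (path i)) , below (fromℕ _) zero close)
  where
  pred-of : ∀ x → x ≢ zero → Σ[ y ∈ Fin _ ] x ≡ suc y
  pred-of zero    x≢0 = ⊥-elim (x≢0 refl)
  pred-of (suc y) _   = y , refl
  d : Fin (3 + ℓ) → Fin _
  d i = proj₁ (pred-of (c i) (λ e → nowhere (i , e)))
  c≡ : ∀ i → c i ≡ suc (d i)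
  c≡ i = proj₂ (pred-of (c i) (λ e → nowhere (i , e)))
  below : ∀ i j → treeAdj (add T p b) (c i) (c j) ≡ true → treeAdj T (d i) (d j) ≡ true
  below i j = subst₂ (λ x y → treeAdj (add T p b) x y ≡ true) (c≡ i) (c≡ j)

-- Recursive decompositions and their tree decompositions

module _ (G : Graph) (w : ℕ) where
  private
    V = Fin (n G)

  -- The recursion of Robertson and Seymour, kept apart from how separators are found. `W` is the
  -- interface of `X` to what has been decomposed already; `w` bounds bag sizes, not width.
  data Decomposition : (X W : FinSet (n G)) → Set where
    tip  : ∀ {X W} → card X ≤ w → Decomposition X W
    fork : ∀ {X W} B X₁ X₂ → W ⊑ B → B ⊑ X → card B ≤ w → X₁ ⊑ X → X₂ ⊑ X →
      (∀ v → X₁ v ≡ true → X₂ v ≡ true → B v ≡ true) →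
      (∀ v → X v ≡ true → X₁ v ≡ true ⊎ X₂ v ≡ true) →
      (∀ u v → X u ≡ true → X v ≡ true → adj G u v ≡ true →
        (X₁ u ≡ true × X₁ v ≡ true) ⊎ (X₂ u ≡ true × X₂ v ≡ true)) →
      Decomposition X₁ (B ∩ X₁) → Decomposition X₂ (B ∩ X₂) → Decomposition X W

  record Valid {m} (T : BagTree (n G) m) : Set where
    field
      hereditary : ∀ v → Hereditary T (λ i → bagOf T i v ≡ true)
      narrow     : ∀ i → card (bagOf T i) ≤ w

  Absent : ∀ {m} → BagTree (n G) m → V → Set
  Absent T v = ∀ i → bagOf T i v ≡ false

  -- `outside` prepares the second branch of a fork: its private vertices must still be absent once
  -- the first branch is attached.
  record Extension {m} (T : BagTree (n G) m) (X : FinSet (n G)) : Set where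
    field
      {size}  : ℕ
      T′      : BagTree (n G) size
      valid   : Valid T′
      embed   : Fin (suc m) → Fin (suc size)
      same    : ∀ i → bagOf T′ (embed i) ≡ bagOf T i
      outside : ∀ v → X v ≡ false → Absent T v → Absent T′ v
      vertex  : ∀ v → X v ≡ true → ∃ λ i → bagOf T′ i v ≡ true
      edge    : ∀ u v → X u ≡ true → X v ≡ true → adj G u v ≡ true →
                ∃ λ i → bagOf T′ i u ≡ true × bagOf T′ i v ≡ true

  -- Ensures that a bag inside `X` hung at `p` never starts a second component for a vertex: the
  -- vertex is in the bag at `p` or entirely new.
  Attachable : ∀ {m} → BagTree (n G) m → Fin (suc m) → (X W : FinSet (n G)) → Set
  Attachable T p X W = ∀ v → X v ≡ true → (W v ≡ true × bagOf T p v ≡ true) ⊎ Absent T v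

  ⊑-false : ∀ {f g : FinSet (n G)} → f ⊑ g → ∀ v → g v ≡ false → f v ≡ false
  ⊑-false {f} h v q with bool-cases (f v)
  ... | inj₁ p = true≢false (h v p) q
  ... | inj₂ p = p

  add-valid : ∀ {m} {T : BagTree (n G) m} {p X W B} → Valid T → Attachable T p X W →
    B ⊑ X → card B ≤ w → Valid (add T p B)
  add-valid {T = T} {p} {X} {W} {B} valid att B⊑X narrow = record
    { hereditary = λ v → Valid.hereditary valid v , new v
    ; narrow     = λ { zero → narrow ; (suc i) → Valid.narrow valid i }
    }
    where
    new : ∀ v → B v ≡ true → bagOf T p v ≡ true ⊎ (∀ i → ¬ bagOf T i v ≡ true)
    new v q with att v (B⊑X v q)
    ... | inj₁ (_ , r) = inj₁ r
    ... | inj₂ none    = inj₂ λ i r → true≢false r (none i)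

  extend : ∀ {X W} → Decomposition X W → ∀ {m} (T : BagTree (n G) m) p → Valid T →
    Attachable T p X W → Extension T X
  extend {X} (tip small) T p valid att = record
    { T′ = add T p X ; valid = add-valid valid att (λ _ q → q) small
    ; embed = suc ; same = λ _ → refl
    ; outside = λ { v q none zero → q ; v q none (suc i) → none i }
    ; vertex = λ v q → zero , q
    ; edge = λ u v qu qv _ → zero , qu , qv
    }
  extend {X} {W} (fork B X₁ X₂ W⊑B B⊑X small X₁⊑X X₂⊑X meet vs es d₁ d₂) T p valid att = record
    { T′ = E₂.T′ ; valid = E₂.valid
    ; embed = E₂.embed ∘ E₁.embed ∘ suc
    ; same = λ i → trans (E₂.same _) (E₁.same (suc i))
    ; outside = λ v q none → E₂.outside v (⊑-false X₂⊑X v q) (E₁.outside v (⊑-false X₁⊑X v q)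
        λ { zero → ⊑-false B⊑X v q ; (suc i) → none i })
    ; vertex = λ v q → [ (λ q₁ → keep v (E₁.vertex v q₁)) , E₂.vertex v ]′ (vs v q)
    ; edge = λ u v qu qv e →
        [ (λ (p₁ , q₁) → keep-edge u v (E₁.edge u v p₁ q₁ e)) , (λ (p₂ , q₂) → E₂.edge u v p₂ q₂ e) ]′
        (es u v qu qv e)
    }
    where
    B-absent : ∀ v → X v ≡ true → B v ≡ false → Absent (add T p B) v
    B-absent v q b with att v q
    ... | inj₁ (r , _) = true≢false (W⊑B v r) b
    ... | inj₂ none    = λ { zero → b ; (suc i) → none i }
    att₁ : Attachable (add T p B) zero X₁ (B ∩ X₁)
    att₁ v q with bool-cases (B v)
    ... | inj₁ b = inj₁ (∧-true b q , b)
    ... | inj₂ b = inj₂ (B-absent v (X₁⊑X v q) b)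
    module E₁ = Extension (extend d₁ (add T p B) zero (add-valid valid att B⊑X small) att₁)
    att₂ : Attachable E₁.T′ (E₁.embed zero) X₂ (B ∩ X₂)
    att₂ v q with bool-cases (B v) | bool-cases (X₁ v)
    ... | inj₁ b | _       = inj₁ (∧-true b q , subst (λ f → f v ≡ true) (≡.sym (E₁.same zero)) b)
    ... | inj₂ b | inj₁ q₁ = true≢false (meet v q₁ q) b
    ... | inj₂ b | inj₂ q₁ = inj₂ (E₁.outside v q₁ (B-absent v (X₂⊑X v q) b))
    -- The second branch hangs at the same node with bag `B`, found again through `embed`.
    module E₂ = Extension (extend d₂ E₁.T′ (E₁.embed zero) E₁.valid att₂)
    keep : ∀ v → (∃ λ i → bagOf E₁.T′ i v ≡ true) → ∃ λ i → bagOf E₂.T′ i v ≡ true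
    keep v (i , q) = E₂.embed i , subst (λ f → f v ≡ true) (≡.sym (E₂.same i)) q
    keep-edge : ∀ u v → (∃ λ i → bagOf E₁.T′ i u ≡ true × bagOf E₁.T′ i v ≡ true) →
      ∃ λ i → bagOf E₂.T′ i u ≡ true × bagOf E₂.T′ i v ≡ true
    keep-edge u v (i , q , r) = E₂.embed i ,
      subst (λ f → f u ≡ true) (≡.sym (E₂.same i)) q , subst (λ f → f v ≡ true) (≡.sym (E₂.same i)) r

  ∈-tabulate : ∀ (f : FinSet (n G)) v → f v ≡ true → v ∈ tabulate f
  ∈-tabulate f v q = lookup⇒[]= v (tabulate f) (trans (lookup∘tabulate f v) q)

  tabulate-∈ : ∀ (f : FinSet (n G)) v → v ∈ tabulate f → f v ≡ true
  tabulate-∈ f v q = trans (≡.sym (lookup∘tabulate f v)) ([]=⇒lookup q)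

  treeDecomp : ∀ {w′} → w ≤ suc w′ → Decomposition (λ _ → true) (λ _ → false) → TreeDecomp G w′
  treeDecomp w≤ d = record
    { T      = shape T′
    ; isTree = s≤s z≤n , hereditary-connected T′ _ (total-hereditary T′) , acyclic T′
    ; bag    = λ i → tabulate (bagOf T′ i)
    ; covV   = λ v → let i , q = vertex v refl in i , ∈-tabulate (bagOf T′ i) v q
    ; covE   = λ u v e → let i , q , r = edge u v refl refl e in
                 i , ∈-tabulate (bagOf T′ i) u q , ∈-tabulate (bagOf T′ i) v r
    ; connV  = λ v i j p q → walk-map (λ l → ∈-tabulate (bagOf T′ l) v)
                 (hereditary-connected T′ _ (Valid.hereditary valid v) i j
                   (tabulate-∈ (bagOf T′ i) v p) (tabulate-∈ (bagOf T′ j) v q))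
    ; width  = λ i → ≤-trans (≤-reflexive (card-tabulate (bagOf T′ i))) (≤-trans (Valid.narrow valid i) w≤)
    }
    where
    -- One empty bag to start from: no vertex occurs in it, so the whole graph is attachable.
    empty : BagTree (n G) 0
    empty = root (λ _ → false)
    empty-valid : Valid empty
    empty-valid = record
      { hereditary = λ _ → tt
      ; narrow     = λ _ → ≤-trans (≤-reflexive (card-∅ (bagOf empty zero) λ _ → refl)) z≤n
      }
    nothing-yet : Attachable empty zero (λ _ → true) (λ _ → false)
    nothing-yet _ _ = inj₂ λ _ → refl
    open Extension (extend d empty zero empty-valid nothing-yet)

-- Balanced separators give a tree decomposition

module Sides {N} (K : ℕ) (X W L S : FinSet N) (W⊑X : W ⊑ X) (W-card : card W ≡ 6 * K)
             (S-small : card S ≤ K) (lower : 2 * K < card (W ∩ L)) (upper : card (W ∩ L) ≤ 4 * K) where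
  open ≤-Reasoning

  S′ X₁ X₂ B : FinSet N
  S′ = S ∩ X
  X₁ = (X ∩ L) ∪ S′
  X₂ = (X ∖ L) ∪ S′
  B  = W ∪ S′

  ∩-fst : (f g : FinSet N) → f ∩ g ⊑ f
  ∩-fst f g x q = proj₁ (∧-split {f x} {g x} q)

  ∩-snd : (f g : FinSet N) → f ∩ g ⊑ g
  ∩-snd f g x q = proj₂ (∧-split {f x} {g x} q)

  ∪-lub : {f g h : FinSet N} → f ⊑ h → g ⊑ h → f ∪ g ⊑ h
  ∪-lub {f} {g} p q x r = [ p x , q x ]′ (∨-split {f x} {g x} r)

  S′-small : card S′ ≤ K
  S′-small = ≤-trans (card-mono (∩-fst S X)) S-small

  B⊑X : B ⊑ X
  B⊑X = ∪-lub {W} {S′} W⊑X (∩-snd S X)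

  X₁⊑X : X₁ ⊑ X
  X₁⊑X = ∪-lub {X ∩ L} {S′} (∩-fst X L) (∩-snd S X)

  X₂⊑X : X₂ ⊑ X
  X₂⊑X = ∪-lub {X ∖ L} {S′} (∩-fst X (not ∘ L)) (∩-snd S X)

  B-small : card B ≤ 7 * K
  B-small = begin
    card B             ≤⟨ card-∪ W S′ ⟩
    card W + card S′   ≤⟨ +-mono-≤ (≤-reflexive W-card) S′-small ⟩
    6 * K + K          ≡⟨ +-comm (6 * K) K ⟩
    7 * K              ∎

  sides : card (W ∩ L) + card (W ∖ L) ≡ 6 * K
  sides = trans (≡.sym (card-∩∖ W L)) W-card

  other-lower : 2 * K ≤ card (W ∖ L)
  other-lower = +-cancelˡ-≤ (4 * K) _ _ (begin
    4 * K + 2 * K                 ≡⟨ *-distribʳ-+ K 4 2 ⟨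
    6 * K                         ≡⟨ sides ⟨
    card (W ∩ L) + card (W ∖ L)   ≤⟨ +-monoˡ-≤ _ upper ⟩
    4 * K + card (W ∖ L)          ∎)

  other-upper : card (W ∖ L) ≤ 4 * K
  other-upper = +-cancelˡ-≤ (2 * K) _ _ (begin
    2 * K + card (W ∖ L)          ≤⟨ +-monoˡ-≤ _ (<⇒≤ lower) ⟩
    card (W ∩ L) + card (W ∖ L)   ≡⟨ sides ⟩
    6 * K                         ≡⟨ *-distribʳ-+ K 2 4 ⟩
    2 * K + 4 * K                 ∎)

  -- The bag meets a side only in that side's share of `W` and in the separator, giving `4 * K + K`,
  -- within the `6 * K` that the recursion allows.
  interface-small : (H : FinSet N) → card (W ∩ H) ≤ 4 * K → card (B ∩ ((X ∩ H) ∪ S′)) ≤ 6 * K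
  interface-small H small = begin
    card (B ∩ ((X ∩ H) ∪ S′))   ≤⟨ card-mono narrow ⟩
    card ((W ∩ H) ∪ S′)         ≤⟨ card-∪ (W ∩ H) S′ ⟩
    card (W ∩ H) + card S′      ≤⟨ +-mono-≤ small S′-small ⟩
    4 * K + K                   ≡⟨ +-comm (4 * K) K ⟩
    5 * K                       ≤⟨ *-monoˡ-≤ K {5} {6} (n≤1+n 5) ⟩
    6 * K                       ∎
    where
    narrow : B ∩ ((X ∩ H) ∪ S′) ⊑ (W ∩ H) ∪ S′
    narrow x q with ∨-split {W x} {S′ x} (∩-fst B ((X ∩ H) ∪ S′) x q)
                  | ∨-split {(X ∩ H) x} {S′ x} (∩-snd B ((X ∩ H) ∪ S′) x q)
    ... | inj₂ s | _      = ∨-trueʳ {(W ∩ H) x} s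
    ... | inj₁ _ | inj₂ s = ∨-trueʳ {(W ∩ H) x} s
    ... | inj₁ r | inj₁ l = ∨-trueˡ (∧-true r (∩-snd X H x l))

  meet : ∀ v → X₁ v ≡ true → X₂ v ≡ true → B v ≡ true
  meet v q₁ q₂ with ∨-split {(X ∩ L) v} {S′ v} q₁ | ∨-split {(X ∖ L) v} {S′ v} q₂
  ... | inj₂ s | _      = ∨-trueʳ {W v} s
  ... | inj₁ _ | inj₂ s = ∨-trueʳ {W v} s
  ... | inj₁ l | inj₁ r = true≢false (∩-snd X L v l) (not-split (∩-snd X (not ∘ L) v r))

  cover : ∀ v → X v ≡ true → X₁ v ≡ true ⊎ X₂ v ≡ true
  cover v q with bool-cases (L v)
  ... | inj₁ l = inj₁ (∨-trueˡ (∧-true q l))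
  ... | inj₂ l = inj₂ (∨-trueˡ (∧-true q (not-true l)))

  edges : (E : Fin N → Fin N → Set) → (∀ {u v} → E u v → E v u) →
    (∀ u v → L u ≡ true → L v ≡ false → E u v → S u ≡ true ⊎ S v ≡ true) →
    ∀ u v → X u ≡ true → X v ≡ true → E u v →
    (X₁ u ≡ true × X₁ v ≡ true) ⊎ (X₂ u ≡ true × X₂ v ≡ true)
  edges E E-sym separates u v qu qv e with bool-cases (L u) | bool-cases (L v)
  ... | inj₁ lu | inj₁ lv = inj₁ (∨-trueˡ (∧-true qu lu) , ∨-trueˡ (∧-true qv lv))
  ... | inj₂ lu | inj₂ lv = inj₂ (∨-trueˡ (∧-true qu (not-true lu)) , ∨-trueˡ (∧-true qv (not-true lv)))
  -- The end in the separator belongs to both sides, so the edge goes with its other end.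
  ... | inj₁ lu | inj₂ lv with separates u v lu lv e
  ...   | inj₁ s = inj₂ (∨-trueʳ {(X ∖ L) u} (∧-true s qu) , ∨-trueˡ (∧-true qv (not-true lv)))
  ...   | inj₂ s = inj₁ (∨-trueˡ (∧-true qu lu) , ∨-trueʳ {(X ∩ L) v} (∧-true s qv))
  edges E E-sym separates u v qu qv e | inj₂ lu | inj₁ lv with separates v u lv lu (E-sym e)
  ...   | inj₁ s = inj₂ (∨-trueˡ (∧-true qu (not-true lu)) , ∨-trueʳ {(X ∖ L) v} (∧-true s qv))
  ...   | inj₂ s = inj₁ (∨-trueʳ {(X ∩ L) u} (∧-true s qu) , ∨-trueˡ (∧-true qv lv))

  -- At least `2 * K` vertices go to the other side and at most `K` return with the separator; this
  -- strict loss makes the recursion terminate.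
  shrink : 1 ≤ K → (Y Z : FinSet N) → card Y + card Z ≡ card X → 2 * K ≤ card Z → card (Y ∪ S′) < card X
  shrink 1≤K Y Z e Z-large = begin-strict
    card (Y ∪ S′)      ≤⟨ card-∪ Y S′ ⟩
    card Y + card S′   ≤⟨ +-monoʳ-≤ (card Y) S′-small ⟩
    card Y + K         <⟨ +-monoʳ-< (card Y) (m<m+n K (≤-trans 1≤K (m≤m+n K 0))) ⟩
    card Y + 2 * K     ≤⟨ +-monoʳ-≤ (card Y) Z-large ⟩
    card Y + card Z    ≡⟨ e ⟩
    card X             ∎

  ∩-monoˡ : (H : FinSet N) → W ∩ H ⊑ X ∩ H
  ∩-monoˡ H x q = ∧-true (W⊑X x (∩-fst W H x q)) (∩-snd W H x q)

  X₁-smaller : 1 ≤ K → card X₁ < card X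
  X₁-smaller 1≤K = shrink 1≤K (X ∩ L) (X ∖ L) (≡.sym (card-∩∖ X L))
    (≤-trans other-lower (card-mono (∩-monoˡ (not ∘ L))))

  X₂-smaller : 1 ≤ K → card X₂ < card X
  X₂-smaller 1≤K = shrink 1≤K (X ∖ L) (X ∩ L) (trans (+-comm (card (X ∖ L)) _) (≡.sym (card-∩∖ X L)))
    (≤-trans (<⇒≤ lower) (card-mono (∩-monoˡ L)))

-- Balanced cuts and the recursion on them

module Balanced (G : Graph) (t : ℕ) (noKtt : ¬ ContainsKtt t G) (1≤t : 1 ≤ t)
                (P : Partition (n G)) (discrete : Discrete P) where
  open Cuts G t noKtt
  open Separators G t noKtt

  -- At most `12` items of at most `3 * t` vertices each.
  K : ℕ
  K = 12 * (3 * t)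

  1≤K : 1 ≤ K
  1≤K = ≤-trans 1≤t (≤-trans (m≤n*m t 3) (m≤n*m (3 * t) 12))

  record BalancedCut (W : FinSet (n G)) : Set where
    field
      L S       : FinSet (n G)
      small     : card S ≤ K
      separates : Separates S L
      lower     : 2 * K < card (W ∩ L)
      upper     : card (W ∩ L) ≤ 4 * K

  leaf-light : ∀ W {L} → (∀ x y → L x ≡ true → L y ≡ true → lab P x ≡ lab P y) → card (W ∩ L) ≤ 2 * K
  leaf-light W {L} one = ≤-trans (card-subsingleton (W ∩ L) λ x y p q →
    discrete (one x y (proj₂ (∧-split {W x} p)) (proj₂ (∧-split {W y} q)))) (≤-trans 1≤K (m≤n*m K 2))

  tree-good : ∀ W {L} → Tree P L → 2 * K < card (W ∩ L) → Good P L
  tree-good W (node _ good _ _ _) _ = good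
  tree-good W (leaf _ one) lo = ⊥-elim (<⇒≱ lo (leaf-light W one))

  finish : ∀ W {L} (T : Tree P L) → 2 * K < card (W ∩ L) → card (W ∩ L) ≤ 4 * K → BalancedCut W
  finish W {L} T lo hi with separator 1≤t P discrete (tree-good W T lo)
  ... | S , small , sep = record { L = L ; S = S ; small = small ; separates = sep ; lower = lo ; upper = hi }

  -- While a node has more than `4 * K` vertices of `W`, some child has more than `2 * K`, and the
  -- descent goes there. It stops before a leaf, which is too light.
  balance : ∀ W {L} → Tree P L → 2 * K < card (W ∩ L) → BalancedCut W
  balance W {L} T lo with card (W ∩ L) ≤? 4 * K
  ... | yes hi = finish W T lo hi
  balance W {L} (leaf _ one) lo | no _ = ⊥-elim (<⇒≱ lo (leaf-light W one))
  balance W {L} (node {L₁ = L₁} {L₂ = L₂} _ _ split T₁ T₂) lo | no hi with 2 * K <? card (W ∩ L₁) | 2 * K <? card (W ∩ L₂)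
  ... | yes lo₁ | _       = balance W T₁ lo₁
  ... | no _    | yes lo₂ = balance W T₂ lo₂
  ... | no hi₁  | no hi₂  = ⊥-elim (hi (begin
    card (W ∩ L)                    ≤⟨ card-mono both ⟩
    card ((W ∩ L₁) ∪ (W ∩ L₂))      ≤⟨ card-∪ (W ∩ L₁) (W ∩ L₂) ⟩
    card (W ∩ L₁) + card (W ∩ L₂)   ≤⟨ +-mono-≤ (≮⇒≥ hi₁) (≮⇒≥ hi₂) ⟩
    2 * K + 2 * K                   ≡⟨ *-distribʳ-+ K 2 2 ⟨
    4 * K                           ∎))
    where
    open ≤-Reasoning
    both : W ∩ L ⊑ (W ∩ L₁) ∪ (W ∩ L₂)
    both x q with ∧-split q
    ... | Wx , Lx with split x Lx
    ...   | inj₁ r = ∨-trueˡ (∧-true Wx r)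
    ...   | inj₂ r = ∨-trueʳ {(W ∩ L₁) x} (∧-true Wx r)

  module _ {L₀} (full : ∀ x → L₀ x ≡ true) (T : Tree P L₀) where

    balanced-cut : ∀ W → card W ≡ 6 * K → BalancedCut W
    balanced-cut W W-card = balance W T (begin-strict
      2 * K             <⟨ *-monoˡ-< K {{>-nonZero 1≤K}} {2} {6} (s≤s (s≤s (s≤s z≤n))) ⟩
      6 * K             ≡⟨ W-card ⟨
      card W            ≤⟨ card-mono (λ x q → ∧-true q (full x)) ⟩
      card (W ∩ L₀)     ∎)
      where open ≤-Reasoning

    decompose : ∀ fuel X W → card X ≤ fuel → W ⊑ X → card W ≤ 6 * K → Decomposition G (7 * K) X W
    decompose fuel X W ≤fuel W⊑X W-small with card X ≤? 7 * K
    ... | yes small = tip small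
    decompose zero X W ≤fuel W⊑X W-small | no large = ⊥-elim (large (≤-trans ≤fuel z≤n))
    decompose (suc fuel) X W ≤fuel W⊑X W-small | no large
      -- `X` has more than `7 * K` vertices here, which leaves room to enlarge `W` to exactly
      -- `6 * K`.
      with card-between W X (6 * K) W⊑X W-small (≤-trans (*-monoˡ-≤ K {6} {7} (n≤1+n 6)) (≰⇒≥ large))
    ... | W′ , W⊑W′ , W′⊑X , W′-card with balanced-cut W′ W′-card
    ...   | record { L = L ; S = S ; small = small ; separates = separates ; lower = lower ; upper = upper } =
      fork B X₁ X₂ (λ x q → ∨-trueˡ (W⊑W′ x q)) B⊑X B-small X₁⊑X X₂⊑X meet cover
        (edges Adj Adj-sym separates)
        (decompose fuel X₁ (B ∩ X₁) (≤-pred (≤-trans (X₁-smaller 1≤K) ≤fuel)) (∩-snd B X₁)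
          (interface-small L upper))
        (decompose fuel X₂ (B ∩ X₂) (≤-pred (≤-trans (X₂-smaller 1≤K) ≤fuel)) (∩-snd B X₂)
          (interface-small (not ∘ L) other-upper))
      where open Sides K X W′ L S W′⊑X W′-card small lower upper

theorem5p8 : ∃ λ (C : ℕ) → ∀ (t : ℕ) → 1 ≤ t → (G : Graph) →
    TwwAtMost 2 G → ¬ ContainsKtt t G → TwAtMost (C * t) G
-- `252` is `7 * 12 * 3`: bags have at most `7 * K` vertices, with `K` equal to `36 * t`. Width `w`
-- allows bags of size `suc w`, hence the final `n≤1+n`.
theorem5p8 = 252 , λ t 1≤t G (P , discrete , seq) noKtt →
  let L , full , T = Separators.tree G t noKtt P seq
      open Balanced G t noKtt 1≤t P discrete
  in treeDecomp G (7 * K)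
       (≤-trans (≤-reflexive (252t t)) (n≤1+n _))
       (decompose full T (card {n G} (λ _ → true)) (λ _ → true) (λ _ → false) ≤-refl (λ _ ())
         (≤-trans (≤-reflexive (card-∅ {n G} (λ _ → false) (λ _ → refl))) z≤n))
  where
  252t : ∀ t → 7 * (12 * (3 * t)) ≡ 252 * t
  252t = solve-∀
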